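{- Let $G=(V,E)$ be a connected graph and let $uu',vv'\in E$ be such that $u,u',v,v'$ are pairwise distinct. Then the inequality $x_{uv}+x_{u'v'}\le x_{uv'}+x_{vu'}$ is valid and facet-defining for $\mathrm{LMC}(G)$ if and only if $\{u,v'\}$ is a $vu'$-separating node set and $\{v,u'\}$ is a $uv'$-separating node set.
   Context: Graphs are finite, simple, undirected; $ab$ denotes $\{a,b\}$. A set $S\subseteq V$ is $ab$-separating if every $ab$-path in $G$ contains at least one node of $S$. A decomposition of $G$ is a partition of $V$ each of whose blocks induces a connected subgraph of $G$; its lifted multicut is the set of pairs $ab\in\binom{V}{2}$ with $a,b$ in distinct blocks. $\mathrm{LMC}(G)\subseteq\mathbb{R}^{\binom{V}{2}}$ is the convex hull of the characteristic vectors of these lifted multicuts over all decompositions of $G$.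
   Formalization: LMC(G) is taken as the set of rational convex combinations of the characteristic vectors of lifted multicuts, inside the rational rather than the real coordinate space; validity and dimensions are over the rationals. -}

module Defs where

open import Data.Nat using (ℕ; zero; suc) renaming (_≤_ to _≤ℕ_)
open import Data.Fin using (Fin; _<_; _<?_) renaming (_≟_ to _≟ᶠ_)
open import Data.Bool using (Bool; true; false)
open import Data.List using (List; []; _∷_)
open import Data.List.Relation.Unary.All using (All)
open import Data.List.Relation.Unary.Any using (Any)
open import Data.List.Relation.Unary.Unique.Propositional using (Unique)
open import Data.Product using (Σ; ∃; ∃-syntax; _×_; _,_; proj₁; proj₂)
open import Data.Rational using (ℚ; 0ℚ; 1ℚ; _+_; _*_; _≤_)
open import Relation.Nullary using (¬_; does; yes; no)
open import Relation.Binary.PropositionalEquality using (_≡_)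

record Graph (n : ℕ) : Set where
  field
    adj    : Fin n → Fin n → Bool
    sym    : ∀ a b → adj a b ≡ adj b a
    irrefl : ∀ a → adj a a ≡ false
open Graph public

Edge : ∀ {n} → Graph n → Fin n → Fin n → Set
Edge G a b = adj G a b ≡ true

data Walk {n} (G : Graph n) : Fin n → Fin n → List (Fin n) → Set where
  stop : ∀ a → Walk G a a (a ∷ [])
  step : ∀ {a c b xs} → Edge G a c → Walk G c b xs → Walk G a b (a ∷ xs)

Path : ∀ {n} → Graph n → Fin n → Fin n → List (Fin n) → Set
Path G a b xs = Walk G a b xs × Unique xs

Connected : ∀ {n} → Graph n → Set
Connected G = ∀ a b → ∃[ xs ] Path G a b xs

Separating : ∀ {n} → Graph n → (Fin n → Set) → Fin n → Fin n → Set
Separating G S a b = ∀ xs → Path G a b xs → Any S xs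

-- Decompositions: a partition of V given by block labels, each block
-- inducing a connected subgraph.

record Decomposition {n} (G : Graph n) : Set where
  field
    label : Fin n → Fin n
    blockConnected : ∀ a b → label a ≡ label b →
      ∃[ xs ] (Path G a b xs × All (λ w → label w ≡ label a) xs)
open Decomposition public

-- Coordinates: unordered pairs ab ∈ (V choose 2), represented as a < b.
Coord : ℕ → Set
Coord n = Σ (Fin n × Fin n) (λ p → proj₁ p < proj₂ p)

Vect : ℕ → Set
Vect n = Coord n → ℚ

-- Value of x at the unordered pair {a,b} (a ≠ b); 0 if a = b (unused).
at : ∀ {n} → Vect n → Fin n → Fin n → ℚ
at x a b with a <? b
... | yes p = x ((a , b) , p)
... | no _ with b <? a
...   | yes q = x ((b , a) , q)
...   | no _ = 0ℚ

lmcVec : ∀ {n} {G : Graph n} → Decomposition G → Vect n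
lmcVec d ((a , b) , _) = if′ (does (label d a ≟ᶠ label d b))
  where
  if′ : Bool → ℚ
  if′ true = 0ℚ
  if′ false = 1ℚ

sumFin : (k : ℕ) → (Fin k → ℚ) → ℚ
sumFin zero f = 0ℚ
sumFin (suc k) f = f Fin.zero + sumFin k (λ i → f (Fin.suc i))

InLMC : ∀ {n} → Graph n → Vect n → Set
InLMC G x = ∃[ k ] Σ (Fin k → Decomposition G) λ d → Σ (Fin k → ℚ) λ μ →
  (∀ i → 0ℚ ≤ μ i) × (sumFin k μ ≡ 1ℚ) ×
  (∀ c → x c ≡ sumFin k (λ i → μ i * lmcVec (d i) c))

AffinelyIndependent : ∀ {n} (k : ℕ) → (Fin k → Vect n) → Set
AffinelyIndependent k p = ∀ (λs : Fin k → ℚ) → sumFin k λs ≡ 0ℚ →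
  (∀ c → sumFin k (λ i → λs i * p i c) ≡ 0ℚ) → ∀ i → λs i ≡ 0ℚ

-- S has affine rank r: r is the maximum number of affinely independent
-- points of S (so dim S = r - 1, with the empty set of dimension -1).
HasAffRank : ∀ {n} → (Vect n → Set) → ℕ → Set
HasAffRank {n} S r =
  (Σ (Fin r → Vect n) λ p → (∀ i → S (p i)) × AffinelyIndependent r p) ×
  (∀ m (p : Fin m → Vect n) → (∀ i → S (p i)) → AffinelyIndependent m p →
     m ≤ℕ r)

record Inequality (n : ℕ) : Set where
  field
    lhs rhs : Vect n → ℚ
open Inequality public

Valid : ∀ {n} → Graph n → Inequality n → Set
Valid G I = ∀ x → InLMC G x → lhs I x ≤ rhs I x

Face : ∀ {n} → Graph n → Inequality n → Vect n → Set
Face G I x = InLMC G x × lhs I x ≡ rhs I x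

-- Facet-defining: dim Face = dim LMC(G) - 1.
FacetDefining : ∀ {n} → Graph n → Inequality n → Set
FacetDefining G I = ∃[ r ] (HasAffRank (InLMC G) (suc r) × HasAffRank (Face G I) r)

ineq : ∀ {n} → Fin n → Fin n → Fin n → Fin n → Inequality n
ineq u u' v v' = record
  { lhs = λ x → at x u v + at x u' v'
  ; rhs = λ x → at x u v' + at x v u' }

{-# OPTIONS --safe #-}
module Submission where

-- Write y = 1 − x, so that a partition with a single non-singleton block S has y_ab = [a ∈ S][b ∈ S].
--
-- Validity: a path violating one of the separation conditions, taken as the only block, violates the
-- inequality; conversely the separation conditions give the inequality block by block at each vertex
-- of LMC(G).
--
-- Facet: if I is the vertex set of the interior of an ab-path, then
--   e_ab = y_{I+a+b} − y_{I+a} − y_{I+b} + y_I,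
-- so LMC(G) has full dimension. A block lies on the face as soon as it contains both or none of u, u',
-- or both or none of v, v'. If a, b ∉ {u, u'}, closing I under the edge uu' puts all four blocks on the
-- face; likewise for vv'. This leaves the four pairs of the inequality. By separation a path
-- from {u, u'} to {v, v'} whose interior avoids all four nodes joins u to v or u' to v'; say u to v,
-- with interior I. Then
--   e_uv + e_uv'  = y_{I+u+v+v'} − y_{I+v+v'} − y_{I+u} + y_I,
--   e_uv + e_vu'  = y_{I+u+u'+v} − y_{I+u+u'} − y_{I+v} + y_I,
--   e_u'v' − e_uv = y_{I+u+u'+v+v'} − y_{I+u+v+v'} − y_{I+u+u'+v} + y_{I+u} + y_{I+v} − y_I
-- span, together with the other e_ab, the hyperplane of the face.

open import Defs renaming (sym to adj-sym)
open import Data.Nat using (ℕ; zero; suc; s≤s) renaming (_+_ to _+ℕ_; _≤_ to _≤ℕ_; _<_ to _<ℕ_)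
open import Data.Nat.Properties using (m<n⇒m<1+n) renaming (≮⇒≥ to ≮⇒≥ℕ)
open import Data.Fin using (Fin; zero; suc; punchIn; splitAt; _<_; _<?_) renaming (_≟_ to _≟ᶠ_)
open import Data.Fin.Properties using (punchInᵢ≢i; <-cmp; <-irrelevant; <-asym; <⇒≢) renaming (any? to anyFin?)
open import Data.List using (List; []; _∷_; length; lookup; filter; cartesianProduct; allFin)
open import Data.List.Membership.Propositional using (_∈_; _∉_; find)
open import Data.List.Membership.Propositional.Properties using (∈-lookup; ∈-filter⁺; ∈-cartesianProduct⁺; ∈-allFin)
open import Data.List.Relation.Unary.All as All using (All; []; _∷_)
open import Data.List.Relation.Unary.All.Properties using (¬Any⇒All¬; all-filter)
open import Data.List.Relation.Unary.AllPairs using ([]; _∷_)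
open import Data.List.Relation.Unary.Any as Any using (Any; here; there; index; any?)
open import Data.List.Relation.Unary.Any.Properties using (lookup-index)
open import Data.List.Relation.Unary.Unique.Propositional using (Unique)
open import Data.List.Relation.Unary.Unique.Propositional.Properties using (filter⁺; cartesianProduct⁺; allFin⁺)
open import Data.Product using (Σ; ∃-syntax; _×_; _,_; proj₁; proj₂)
open import Data.Product.Properties using (≡-dec)
open import Data.Rational using (ℚ; 0ℚ; 1ℚ; ½; _+_; _*_; _-_; -_; _≤_; _≤?_; 1/_; ≢-nonZero; nonNegative)
open import Data.Rational.Properties using (_≟_; +-comm; +-assoc; +-identityˡ; +-identityʳ; +-mono-≤; *-comm; *-assoc; *-identityˡ; *-identityʳ; *-zeroˡ; *-zeroʳ; *-inverseˡ; *-distribˡ-+; *-monoˡ-≤-nonNeg; ≤-refl; ≤-reflexive; nonNegative⁻¹)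
open import Data.Rational.Solver using (module +-*-Solver)
open import Data.Sum using (_⊎_; inj₁; inj₂; [_,_]′)
open import Data.Vec.Functional using (insertAt)
open import Data.Vec.Functional.Properties using (insertAt-lookup; insertAt-punchIn)
open import Function using (_∘_; id)
open import Function.Bundles using (_⇔_; mk⇔)
open import Relation.Binary.Definitions using (tri<; tri≈; tri>)
open import Relation.Binary.PropositionalEquality using (_≡_; _≢_; refl; sym; trans; cong; cong₂; subst; subst₂; ≢-sym; module ≡-Reasoning)
open import Relation.Nullary using (¬_; Dec; yes; no; contradiction; ¬?; _×-dec_; _⊎-dec_)
open import Relation.Nullary.Decidable using (decidable-stable; from-no)
open import Relation.Unary using (Decidable)
import Data.List.Membership.DecPropositional as DecMembership

open +-*-Solver using (solve; _:=_; _:+_; _:*_; _:-_; :-_; con)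

-- Finite sums of rationals

sum-cong : ∀ k {f g : Fin k → ℚ} → (∀ i → f i ≡ g i) → sumFin k f ≡ sumFin k g
sum-cong zero    eq = refl
sum-cong (suc k) eq = cong₂ _+_ (eq zero) (sum-cong k (eq ∘ suc))

sum-zero : ∀ k {f : Fin k → ℚ} → (∀ i → f i ≡ 0ℚ) → sumFin k f ≡ 0ℚ
sum-zero zero    eq = refl
sum-zero (suc k) eq = cong₂ _+_ (eq zero) (sum-zero k (eq ∘ suc))

sum-+ : ∀ k (f g : Fin k → ℚ) → sumFin k (λ i → f i + g i) ≡ sumFin k f + sumFin k g
sum-+ zero    f g = refl
sum-+ (suc k) f g = trans (cong (f zero + g zero +_) (sum-+ k (f ∘ suc) (g ∘ suc)))
  (solve 4 (λ a b s t → a :+ b :+ (s :+ t) := a :+ s :+ (b :+ t)) refl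
    (f zero) (g zero) (sumFin k (f ∘ suc)) (sumFin k (g ∘ suc)))

sum-*ˡ : ∀ k r (f : Fin k → ℚ) → sumFin k (λ i → r * f i) ≡ r * sumFin k f
sum-*ˡ zero    r f = sym (*-zeroʳ r)
sum-*ˡ (suc k) r f = trans (cong (r * f zero +_) (sum-*ˡ k r (f ∘ suc)))
  (sym (*-distribˡ-+ r (f zero) (sumFin k (f ∘ suc))))

sum-*ʳ : ∀ k r (f : Fin k → ℚ) → sumFin k (λ i → f i * r) ≡ sumFin k f * r
sum-*ʳ k r f = trans (sum-cong k (λ i → *-comm (f i) r))
  (trans (sum-*ˡ k r f) (*-comm r (sumFin k f)))

sum-punchIn : ∀ k (i : Fin (suc k)) (f : Fin (suc k) → ℚ) →
  sumFin (suc k) f ≡ f i + sumFin k (f ∘ punchIn i)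
sum-punchIn k       zero    f = refl
sum-punchIn (suc k) (suc i) f = trans (cong (f zero +_) (sum-punchIn k i (f ∘ suc)))
  (solve 3 (λ a b s → a :+ (b :+ s) := b :+ (a :+ s)) refl
    (f zero) (f (suc i)) (sumFin k (f ∘ suc ∘ punchIn i)))

sum-mono : ∀ k {f g : Fin k → ℚ} → (∀ i → f i ≤ g i) → sumFin k f ≤ sumFin k g
sum-mono zero    le = ≤-refl
sum-mono (suc k) le = +-mono-≤ (le zero) (sum-mono k (le ∘ suc))

-- The observable `h` is arbitrary so that one statement serves both the total weight and each
-- coordinate of two concatenated convex combinations.
sum-splitAt : ∀ k l {A : Set} (f : Fin k → A) (g : Fin l → A) (h : A → ℚ) →
  sumFin (k +ℕ l) (h ∘ [ f , g ]′ ∘ splitAt k) ≡ sumFin k (h ∘ f) + sumFin l (h ∘ g)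
sum-splitAt zero    l f g h = sym (+-identityˡ _)
sum-splitAt (suc k) l f g h = trans
  (cong (h (f zero) +_) (trans (sum-cong (k +ℕ l) step-eq) (sum-splitAt k l (f ∘ suc) g h)))
  (sym (+-assoc (h (f zero)) _ _))
  where
  step-eq : ∀ i → h ([ f , g ]′ (splitAt (suc k) (suc i))) ≡ h ([ f ∘ suc , g ]′ (splitAt k i))
  step-eq i with splitAt k i
  ... | inj₁ _ = refl
  ... | inj₂ _ = refl

-- Linear dependence over the rationals

p*q≡0⇒q≡0 : ∀ {p q} → p ≢ 0ℚ → p * q ≡ 0ℚ → q ≡ 0ℚ
p*q≡0⇒q≡0 {p} {q} p≢0 pq≡0 = begin
  q                ≡⟨ *-identityˡ q ⟨
  1ℚ * q           ≡⟨ cong (_* q) (*-inverseˡ p) ⟨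
  1/ p * p * q     ≡⟨ *-assoc (1/ p) p q ⟩
  1/ p * (p * q)   ≡⟨ cong (1/ p *_) pq≡0 ⟩
  1/ p * 0ℚ        ≡⟨ *-zeroʳ (1/ p) ⟩
  0ℚ               ∎
  where
  open ≡-Reasoning
  instance _ = ≢-nonZero p≢0

LinearRelation : ∀ {m k} → (Fin m → Fin k → ℚ) → (Fin m → ℚ) → Set
LinearRelation {m} A μ = ∀ j → sumFin m (λ i → μ i * A i j) ≡ 0ℚ

-- Gaussian elimination of the first column, cross-multiplied to avoid division.
dependent : ∀ k m (A : Fin m → Fin k → ℚ) → k <ℕ m →
  ∃[ μ ] LinearRelation A μ × ∃[ i ] μ i ≢ 0ℚ
dependent zero    (suc m) A _ = (λ _ → 1ℚ) , (λ ()) , zero , λ ()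
dependent (suc k) (suc m) A (s≤s k<m) with anyFin? (λ i → ¬? (A i zero ≟ 0ℚ))
... | no column≡0 = μ , relation , nontrivial
  where
  tail-dependent : ∃[ μ ] LinearRelation (λ i → A i ∘ suc) μ × ∃[ i ] μ i ≢ 0ℚ
  tail-dependent = dependent k (suc m) (λ i → A i ∘ suc) (m<n⇒m<1+n k<m)
  μ = proj₁ tail-dependent
  nontrivial = proj₂ (proj₂ tail-dependent)
  relation : LinearRelation A μ
  relation zero    = sum-zero (suc m) λ i → trans
    (cong (μ i *_) (decidable-stable (A i zero ≟ 0ℚ) λ A≢0 → column≡0 (i , A≢0))) (*-zeroʳ (μ i))
  relation (suc j) = proj₁ (proj₂ tail-dependent) j
... | yes (r , pivot≢0) = insertAt μ r ν , relation , punchIn r (proj₁ nontrivial) , λ eq →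
      proj₂ nontrivial (p*q≡0⇒q≡0 pivot≢0
        (trans (sym (insertAt-punchIn μ r ν (proj₁ nontrivial))) eq))
  where
  pivot = A r zero
  rest : Fin m → Fin (suc k) → ℚ
  rest = A ∘ punchIn r
  eliminated : Fin m → Fin k → ℚ
  eliminated i j = pivot * rest i (suc j) - rest i zero * A r (suc j)
  reduced : ∃[ μ ] LinearRelation eliminated μ × ∃[ i ] μ i ≢ 0ℚ
  reduced = dependent k m eliminated k<m
  μ′ = proj₁ reduced
  nontrivial = proj₂ (proj₂ reduced)
  μ : Fin m → ℚ
  μ i = pivot * μ′ i
  s : ℚ
  s = sumFin m (λ i → μ′ i * rest i zero)
  -- The other coefficients are scaled by `pivot`, so this choice for the pivot row cancels the
  -- first column.
  ν : ℚ
  ν = - s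
  split : ∀ j → sumFin (suc m) (λ i → insertAt μ r ν i * A i j)
              ≡ ν * A r j + sumFin m (λ i → pivot * (μ′ i * rest i j))
  split j = trans (sum-punchIn m r (λ i → insertAt μ r ν i * A i j)) (cong₂ _+_
    (cong (_* A r j) (insertAt-lookup μ r ν))
    (sum-cong m λ i → trans (cong (_* rest i j) (insertAt-punchIn μ r ν i)) (*-assoc pivot (μ′ i) _)))
  relation : LinearRelation A (insertAt μ r ν)
  relation zero    = trans (split zero) (trans (cong (ν * pivot +_) (sum-*ˡ m pivot _))
    (solve 2 (λ s p → :- s :* p :+ p :* s := con 0ℚ) refl s pivot))
  relation (suc j) = trans (split (suc j)) (trans (cong (_+ t) ν*)
      (trans (sym (sum-+ m _ _)) (trans (sum-cong m regroup) (proj₁ (proj₂ reduced) j))))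
    where
    t = sumFin m (λ i → pivot * (μ′ i * rest i (suc j)))
    ν* : ν * A r (suc j) ≡ sumFin m (λ i → - A r (suc j) * (μ′ i * rest i zero))
    ν* = trans (solve 2 (λ s a → :- s :* a := :- a :* s) refl s (A r (suc j)))
      (sym (sum-*ˡ m (- A r (suc j)) _))
    regroup : ∀ i → - A r (suc j) * (μ′ i * rest i zero) + pivot * (μ′ i * rest i (suc j))
                  ≡ μ′ i * eliminated i j
    regroup i = solve 5 (λ a μ z p x → :- a :* (μ :* z) :+ p :* (μ :* x) := μ :* (p :* x :- z :* a)) refl
      (A r (suc j)) (μ′ i) (rest i zero) pivot (rest i (suc j))

-- Unit vectors and affine rank

δ : ∀ {n} → Fin n → Fin n → ℚ
δ i j with i ≟ᶠ j
... | yes _ = 1ℚ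
... | no  _ = 0ℚ

δ-refl : ∀ {n} (i : Fin n) → δ i i ≡ 1ℚ
δ-refl i with i ≟ᶠ i
... | yes _  = refl
... | no i≢i = contradiction refl i≢i

δ-≢ : ∀ {n} {i j : Fin n} → i ≢ j → δ i j ≡ 0ℚ
δ-≢ {i = i} {j} i≢j with i ≟ᶠ j
... | yes i≡j = contradiction i≡j i≢j
... | no _    = refl

sum-δ : ∀ k (f : Fin k → ℚ) j → sumFin k (λ i → f i * δ i j) ≡ f j
sum-δ (suc k) f j = begin
  sumFin (suc k) (λ i → f i * δ i j)                            ≡⟨ sum-punchIn k j (λ i → f i * δ i j) ⟩
  f j * δ j j + sumFin k (λ i → f (punchIn j i) * δ (punchIn j i) j)
    ≡⟨ cong₂ _+_ (trans (cong (f j *_) (δ-refl j)) (*-identityʳ (f j)))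
         (sum-zero k λ i → trans (cong (f (punchIn j i) *_) (δ-≢ (punchInᵢ≢i j i)))
           (*-zeroʳ (f (punchIn j i)))) ⟩
  f j + 0ℚ                                                      ≡⟨ +-identityʳ (f j) ⟩
  f j                                                           ∎
  where open ≡-Reasoning

-- Convexity of the sets under study enters only as closure under this operation.
mid : ∀ {n} → Vect n → Vect n → Vect n
mid x y c = ½ * (x c + y c)

module AffineRank {n} {K : Vect n → Set} {R : ℕ} (cs : Fin R → Coord n) where

  -- For `LMC(G)` the list `cs` is complete. For the face it omits the pair `uv`, whose coordinate
  -- the equation of the face recovers.
  Determined : Set
  Determined = ∀ m (p : Fin m → Vect n) → (∀ i → K (p i)) → ∀ (μ : Fin m → ℚ) → sumFin m μ ≡ 0ℚ →
    (∀ j → sumFin m (λ i → μ i * p i (cs j)) ≡ 0ℚ) → ∀ c → sumFin m (λ i → μ i * p i c) ≡ 0ℚ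

  -- A homogenizing coordinate equal to 1 turns affine relations into linear ones, so more than
  -- `R + 1` points are dependent already on `cs`; `Determined` carries the relation to all
  -- coordinates.
  rank-≤ : Determined → ∀ m (p : Fin m → Vect n) → (∀ i → K (p i)) →
    AffinelyIndependent m p → m ≤ℕ suc R
  rank-≤ determined m p p∈K independent = ≮⇒≥ℕ λ R<m →
    let homogeneous : Fin m → Fin (suc R) → ℚ
        homogeneous = λ i → λ { zero → 1ℚ ; (suc j) → p i (cs j) }
        μ , relation , i , μi≢0 = dependent (suc R) m homogeneous R<m
        Σμ≡0 = trans (sum-cong m (λ i → sym (*-identityʳ (μ i)))) (relation zero)
    in μi≢0 (independent μ Σμ≡0 (determined m p p∈K μ Σμ≡0 (relation ∘ suc)) i)

  -- The segment may lie anywhere in `K`, and only its projection to `cs` counts, up to a nonzero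
  -- factor.
  record Direction (t : Fin R → ℚ) : Set where
    constructor direction
    field
      {from to} : Vect n
      from∈K    : K from
      to∈K      : K to
      scale     : ℚ
      scale≢0   : scale ≢ 0ℚ
      to-from   : ∀ j → to (cs j) ≡ from (cs j) + scale * t j

  module _ (K-mid : ∀ {x y} → K x → K y → K (mid x y)) {o : Vect n} (o∈K : K o) where

    -- Averaging with one more pair from, to moves the apex and halves the old edges,
    -- so the directions can be collected one at a time.
    collect : ∀ k (t : Fin k → Fin R → ℚ) → (∀ i → Direction (t i)) →
      ∃[ z ] K z × Σ (Fin k → Vect n) λ p → Σ (Fin k → ℚ) λ ε →
        (∀ i → K (p i)) × (∀ i → ε i ≢ 0ℚ) × (∀ i j → p i (cs j) ≡ z (cs j) + ε i * t i j)
    collect zero    t d = o , o∈K , (λ ()) , (λ ()) , (λ ()) , (λ ()) , λ ()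
    collect (suc k) t d =
      let z , z∈K , p , ε , p∈K , ε≢0 , eq = collect k (t ∘ suc) (d ∘ suc)
          open Direction (d zero)
      in mid z from , K-mid z∈K from∈K
       , (λ { zero → mid z to ; (suc i) → mid (p i) from })
       , (λ { zero → ½ * scale ; (suc i) → ½ * ε i })
       , (λ { zero → K-mid z∈K to∈K ; (suc i) → K-mid (p∈K i) from∈K })
       , (λ { zero → scale≢0 ∘ p*q≡0⇒q≡0 {½} (λ ()) ; (suc i) → ε≢0 i ∘ p*q≡0⇒q≡0 {½} (λ ()) })
       , λ { zero j → trans (cong (λ y → ½ * (z (cs j) + y)) (to-from j))
               (solve 5 (λ h z f s t → h :* (z :+ (f :+ s :* t)) := h :* (z :+ f) :+ h :* s :* t) refl
                 ½ (z (cs j)) (from (cs j)) scale (t zero j))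
           ; (suc i) j → trans (cong (λ y → ½ * (y + from (cs j))) (eq i j))
               (solve 5 (λ h z f s t → h :* (z :+ s :* t :+ f) := h :* (z :+ f) :+ h :* s :* t) refl
                 ½ (z (cs j)) (from (cs j)) (ε i) (t (suc i) j)) }

    -- The collected points sit at an apex `z` plus `ε i` times a unit vector on `cs`. An affine
    -- relation read at `cs j` therefore isolates the coefficient of the `j`-th point; the
    -- coefficient of the apex follows from the zero sum.
    simplex : (∀ i → Direction (δ i)) →
      Σ (Fin (suc R) → Vect n) λ p → (∀ i → K (p i)) × AffinelyIndependent (suc R) p
    simplex d with collect R δ d
    ... | z , z∈K , p , ε , p∈K , ε≢0 , eq =
      vertices , (λ { zero → z∈K ; (suc i) → p∈K i }) , independent
      where
      vertices : Fin (suc R) → Vect n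
      vertices zero    = z
      vertices (suc i) = p i
      independent : AffinelyIndependent (suc R) vertices
      independent μ Σμ≡0 relation = λ { zero → μ₀≡0 ; (suc j) → μⱼ≡0 j }
        where
        open ≡-Reasoning
        S = sumFin R (μ ∘ suc)
        εμ≡0 : ∀ j → ε j * μ (suc j) ≡ 0ℚ
        εμ≡0 j = begin
          ε j * μ (suc j)
            ≡⟨ *-comm (ε j) (μ (suc j)) ⟩
          μ (suc j) * ε j
            ≡⟨ sum-δ R (λ i → μ (suc i) * ε i) j ⟨
          T
            -- A zero multiple of the apex coordinate is inserted and then rewritten as the sum of
            -- all coefficients times it, which completes each summand to a coordinate of a vertex.
            ≡⟨ solve 2 (λ T x → T := con 0ℚ :* x :+ T) refl T x ⟩
          0ℚ * x + T
            ≡⟨ cong (λ y → y * x + T) (sym Σμ≡0) ⟩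
          (μ zero + S) * x + T
            ≡⟨ solve 4 (λ m s x T → (m :+ s) :* x :+ T := m :* x :+ (s :* x :+ T)) refl (μ zero) S x T ⟩
          μ zero * x + (S * x + T)
            ≡⟨ cong (λ y → μ zero * x + (y + T)) (sum-*ʳ R x (μ ∘ suc)) ⟨
          μ zero * x + (sumFin R (λ i → μ (suc i) * x) + T)
            ≡⟨ cong (μ zero * x +_) (sum-+ R _ _) ⟨
          μ zero * x + sumFin R (λ i → μ (suc i) * x + μ (suc i) * ε i * δ i j)
            ≡⟨ cong (μ zero * x +_) (sum-cong R λ i → trans
                 (solve 4 (λ m x e d → m :* x :+ m :* e :* d := m :* (x :+ e :* d)) refl
                   (μ (suc i)) x (ε i) (δ i j))
                 (cong (μ (suc i) *_) (sym (eq i j)))) ⟩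
          μ zero * x + sumFin R (λ i → μ (suc i) * p i (cs j))
            ≡⟨ relation (cs j) ⟩
          0ℚ ∎
          where
          x = z (cs j)
          T = sumFin R (λ i → μ (suc i) * ε i * δ i j)
        μⱼ≡0 : ∀ j → μ (suc j) ≡ 0ℚ
        μⱼ≡0 j = p*q≡0⇒q≡0 (ε≢0 j) (εμ≡0 j)
        μ₀≡0 : μ zero ≡ 0ℚ
        μ₀≡0 = begin
          μ zero        ≡⟨ +-identityʳ (μ zero) ⟨
          μ zero + 0ℚ   ≡⟨ cong (μ zero +_) (sum-zero R μⱼ≡0) ⟨
          μ zero + S    ≡⟨ Σμ≡0 ⟩
          0ℚ            ∎

-- Coordinates, multicut vectors and indicators of blocks

module _ {n : ℕ} where
  open DecMembership (_≟ᶠ_ {n}) public using (_∈?_)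

lmcVec-together : ∀ {n} {G : Graph n} (d : Decomposition G) {a b} (a<b : a < b) →
  label d a ≡ label d b → lmcVec d ((a , b) , a<b) ≡ 0ℚ
lmcVec-together d {a} {b} _ eq with label d a ≟ᶠ label d b
... | yes _  = refl
... | no neq = contradiction eq neq

lmcVec-apart : ∀ {n} {G : Graph n} (d : Decomposition G) {a b} (a<b : a < b) →
  label d a ≢ label d b → lmcVec d ((a , b) , a<b) ≡ 1ℚ
lmcVec-apart d {a} {b} _ neq with label d a ≟ᶠ label d b
... | yes eq = contradiction eq neq
... | no _   = refl

coord-≡ : ∀ {n} {c c′ : Coord n} → proj₁ c ≡ proj₁ c′ → c ≡ c′
coord-≡ {c = p , a<b} {_ , a<b′} refl = cong (p ,_) (<-irrelevant a<b a<b′)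

at-< : ∀ {n} (x : Vect n) {a b} (a<b : a < b) → at x a b ≡ x ((a , b) , a<b)
at-< x {a} {b} a<b with a <? b
... | yes _  = cong x (coord-≡ refl)
... | no a≮b = contradiction a<b a≮b

at-> : ∀ {n} (x : Vect n) {a b} (a<b : a < b) → at x b a ≡ x ((a , b) , a<b)
at-> x {a} {b} a<b with b <? a
... | yes b<a = contradiction b<a (<-asym a<b)
... | no _ with a <? b
...   | yes _  = cong x (coord-≡ refl)
...   | no a≮b = contradiction a<b a≮b

at-comm : ∀ {n} (x : Vect n) a b → at x a b ≡ at x b a
at-comm x a b with <-cmp a b
... | tri< a<b _ _  = trans (at-< x a<b) (sym (at-> x a<b))
... | tri≈ _ refl _ = refl
... | tri> _ _ b<a  = trans (at-> x b<a) (sym (at-< x b<a))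

-- The coordinate does not depend on `x`, so a linear identity between vectors at `c` transfers to
-- `at`.
at-coord : ∀ {n} {a b : Fin n} → a ≢ b → ∃[ c ]
  (proj₁ c ≡ (a , b) ⊎ proj₁ c ≡ (b , a)) × (∀ (x : Vect n) → at x a b ≡ x c)
at-coord {a = a} {b} a≢b with <-cmp a b
... | tri< a<b _ _ = ((a , b) , a<b) , inj₁ refl , λ x → at-< x a<b
... | tri≈ _ a≡b _ = contradiction a≡b a≢b
... | tri> _ _ b<a = ((b , a) , b<a) , inj₂ refl , λ x → at-> x b<a

-- The incidence vector of the partition with one block of characteristic function f
-- and singletons elsewhere.
blockVec : ∀ {n} → (Fin n → ℚ) → Vect n
blockVec f ((a , b) , _) = 1ℚ - f a * f b

at-blockVec : ∀ {n} (f : Fin n → ℚ) {a b} → a ≢ b → at (blockVec f) a b ≡ 1ℚ - f a * f b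
at-blockVec f {a} {b} a≢b with at-coord a≢b
... | _ , inj₁ refl , eq = eq (blockVec f)
... | _ , inj₂ refl , eq = trans (eq (blockVec f)) (cong (λ p → 1ℚ - p) (*-comm (f b) (f a)))

at-lmcVec-together : ∀ {n} {G : Graph n} (d : Decomposition G) {a b} → a ≢ b →
  label d a ≡ label d b → at (lmcVec d) a b ≡ 0ℚ
at-lmcVec-together d a≢b eq with at-coord a≢b
... | (_ , lt) , inj₁ refl , at-eq = trans (at-eq (lmcVec d)) (lmcVec-together d lt eq)
... | (_ , lt) , inj₂ refl , at-eq = trans (at-eq (lmcVec d)) (lmcVec-together d lt (sym eq))

at-lmcVec-apart : ∀ {n} {G : Graph n} (d : Decomposition G) {a b} → a ≢ b →
  label d a ≢ label d b → at (lmcVec d) a b ≡ 1ℚ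
at-lmcVec-apart d a≢b neq with at-coord a≢b
... | (_ , lt) , inj₁ refl , at-eq = trans (at-eq (lmcVec d)) (lmcVec-apart d lt neq)
... | (_ , lt) , inj₂ refl , at-eq = trans (at-eq (lmcVec d)) (lmcVec-apart d lt (neq ∘ sym))

mem : ∀ {n} → List (Fin n) → Fin n → ℚ
mem xs w with w ∈? xs
... | yes _ = 1ℚ
... | no _  = 0ℚ

mem-∈ : ∀ {n} {xs : List (Fin n)} {w} → w ∈ xs → mem xs w ≡ 1ℚ
mem-∈ {xs = xs} {w} w∈xs with w ∈? xs
... | yes _   = refl
... | no w∉xs = contradiction w∈xs w∉xs

mem-∉ : ∀ {n} {xs : List (Fin n)} {w} → w ∉ xs → mem xs w ≡ 0ℚ
mem-∉ {xs = xs} {w} w∉xs with w ∈? xs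
... | yes w∈xs = contradiction w∈xs w∉xs
... | no _     = refl

mem-∷-≢ : ∀ {n} {x} {xs : List (Fin n)} {w} → x ≢ w → mem (x ∷ xs) w ≡ mem xs w
mem-∷-≢ {x = x} {xs} {w} x≢w = go (w ∈? xs)
  where
  go : Dec (w ∈ xs) → mem (x ∷ xs) w ≡ mem xs w
  go (yes w∈xs) = trans (mem-∈ {xs = x ∷ xs} (there w∈xs)) (sym (mem-∈ w∈xs))
  go (no w∉xs)  = trans
    (mem-∉ {xs = x ∷ xs} λ { (here w≡x) → x≢w (sym w≡x) ; (there w∈xs) → w∉xs w∈xs })
    (sym (mem-∉ w∉xs))

-- Freshness of `x` makes indicators additive, so the vectors of growing blocks become polynomials
-- in the `δ`s and can be compared by ring normalization.
mem-∷ : ∀ {n} {x} {xs : List (Fin n)} → x ∉ xs → ∀ w → mem (x ∷ xs) w ≡ δ x w + mem xs w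
mem-∷ {x = x} {xs} x∉xs w = go (w ∈? xs) (x ≟ᶠ w)
  where
  go : Dec (w ∈ xs) → Dec (x ≡ w) → mem (x ∷ xs) w ≡ δ x w + mem xs w
  go (yes w∈xs) _ = trans (mem-∈ {xs = x ∷ xs} (there w∈xs))
    (sym (cong₂ _+_ (δ-≢ {i = x} {w} λ { refl → x∉xs w∈xs }) (mem-∈ w∈xs)))
  go (no w∉xs) (yes refl) = trans (mem-∈ {xs = x ∷ xs} (here refl))
    (sym (cong₂ _+_ (δ-refl x) (mem-∉ w∉xs)))
  go (no w∉xs) (no x≢w) = trans
    (mem-∉ {xs = x ∷ xs} λ { (here w≡x) → x≢w (sym w≡x) ; (there w∈xs) → w∉xs w∈xs })
    (sym (cong₂ _+_ (δ-≢ x≢w) (mem-∉ w∉xs)))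

-- The polarization of the quadratic form `f a * f b` that occurs in `blockVec`.
cross : ∀ {n} → (Fin n → ℚ) → (Fin n → ℚ) → Vect n
cross f g ((w , w′) , _) = f w * g w′ + g w * f w′

-- For `a ≢ b`, the unit vector of the pair `ab`.
E : ∀ {n} → Fin n → Fin n → Vect n
E a b = cross (δ a) (δ b)

E-same : ∀ {n} {a b : Fin n} (a<b : a < b) → E a b ((a , b) , a<b) ≡ 1ℚ
E-same {a = a} {b} a<b rewrite δ-refl a | δ-refl b | δ-≢ (<⇒≢ a<b) | *-zeroʳ (δ b a) = refl

E-other : ∀ {n} {a b : Fin n} (c : Coord n) → proj₁ c ≢ (a , b) → proj₁ c ≢ (b , a) → E a b c ≡ 0ℚ
E-other {a = a} {b} ((w , w′) , _) c≢ab c≢ba = cong₂ _+_ (product-zero a b c≢ab) (product-zero b a c≢ba)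
  where
  product-zero : ∀ s t → (w , w′) ≢ (s , t) → δ s w * δ t w′ ≡ 0ℚ
  product-zero s t ≢st with s ≟ᶠ w | t ≟ᶠ w′
  ... | yes refl | yes refl = contradiction refl ≢st
  ... | yes _    | no _     = refl
  ... | no _     | yes _    = refl
  ... | no _     | no _     = refl

E-comm : ∀ {n} (a b : Fin n) c → E a b c ≡ E b a c
E-comm a b ((w , w′) , _) = +-comm (δ a w * δ b w′) (δ b w * δ a w′)

-- Connected vertex sets and their decompositions

collapse : ∀ {n} → List (Fin n) → Fin n → Fin n
collapse []         w = w
collapse xs@(r ∷ _) w with w ∈? xs
... | yes _ = r
... | no _  = w

collapse-∈ : ∀ {n} {xs : List (Fin n)} {a b} → a ∈ xs → b ∈ xs → collapse xs a ≡ collapse xs b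
collapse-∈ {xs = xs@(_ ∷ _)} {a} {b} a∈xs b∈xs with a ∈? xs | b ∈? xs
... | yes _   | yes _   = refl
... | no a∉xs | _       = contradiction a∈xs a∉xs
... | _       | no b∉xs = contradiction b∈xs b∉xs

-- The representative `r` is itself in the block, so it cannot coincide with the label of a vertex
-- outside.
collapse-≡ : ∀ {n} (xs : List (Fin n)) {a b} → collapse xs a ≡ collapse xs b → (a ∈ xs × b ∈ xs) ⊎ a ≡ b
collapse-≡ []         eq = inj₂ eq
collapse-≡ xs@(r ∷ _) {a} {b} eq with a ∈? xs | b ∈? xs
... | yes a∈xs | yes b∈xs = inj₁ (a∈xs , b∈xs)
... | yes _    | no b∉xs  = contradiction (here (sym eq)) b∉xs
... | no a∉xs  | yes _    = contradiction (here eq) a∉xs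
... | no _     | no _     = inj₂ eq

module _ {n} (G : Graph n) where

  edge-sym : ∀ {a b} → Edge G a b → Edge G b a
  edge-sym {a} {b} e = trans (adj-sym G b a) e

  Reach : (Fin n → Set) → Fin n → Fin n → Set
  Reach P a b = ∃[ xs ] Walk G a b xs × All P xs

  reach-trans : ∀ {P a b c} → Reach P a b → Reach P b c → Reach P a c
  reach-trans (_ , stop _   , _)      r = r
  reach-trans (_ , step e w , p ∷ ps) r =
    let xs , w′ , ps′ = reach-trans (_ , w , ps) r in _ ∷ xs , step e w′ , p ∷ ps′

  walk-start : ∀ {a b xs} → Walk G a b xs → a ∈ xs
  walk-start (stop _)   = here refl
  walk-start (step _ _) = here refl

  walk-end : ∀ {a b xs} → Walk G a b xs → b ∈ xs
  walk-end (stop _)   = here refl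
  walk-end (step _ w) = there (walk-end w)

  reach-sym : ∀ {P a b} → Reach P a b → Reach P b a
  reach-sym (_ , stop a   , ps)     = _ , stop a , ps
  reach-sym (_ , step e w , p ∷ ps) = reach-trans (reach-sym (_ , w , ps))
    (_ , step (edge-sym e) (stop _) , All.lookup ps (walk-start w) ∷ p ∷ [])

  suffix : ∀ {P : Fin n → Set} {a b c xs} → Path G c b xs → All P xs → a ∈ xs → ∃[ ys ] Path G a b ys × All P ys
  suffix π@(stop _ , _)          ps       (here refl)  = _ , π , ps
  suffix π@(step _ _ , _)        ps       (here refl)  = _ , π , ps
  suffix (step _ w , (_ ∷ uniq)) (_ ∷ ps) (there a∈xs) = suffix (w , uniq) ps a∈xs

  -- Loop erasure: if the new start already occurs on the path, `suffix` restarts the path there.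
  reach⇒path : ∀ {P a b} → Reach P a b → ∃[ xs ] Path G a b xs × All P xs
  reach⇒path (_ , stop a   , ps) = _ , (stop a , [] ∷ []) , ps
  reach⇒path {a = a} (_ , step e w , p ∷ ps) with reach⇒path (_ , w , ps)
  ... | ys , (w′ , uniq) , ps′ with a ∈? ys
  ...   | yes a∈ys = suffix (w′ , uniq) ps′ a∈ys
  ...   | no a∉ys  = a ∷ ys , (step e w′ , ¬Any⇒All¬ ys a∉ys ∷ uniq) , p ∷ ps′

  Attached : Fin n → List (Fin n) → Set
  Attached a xs = xs ≡ [] ⊎ Any (Edge G a) xs

  -- A construction order witnessing connectedness. Repeated vertices are allowed, so that any walk
  -- qualifies; the empty list is allowed, being the interior of an edge.
  data Tree : List (Fin n) → Set where
    nil  : Tree []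
    grow : ∀ {a xs} → Tree xs → Attached a xs → Tree (a ∷ xs)

  walk-tree : ∀ {a b xs} → Walk G a b xs → Tree xs
  walk-tree (stop _)              = grow nil (inj₁ refl)
  walk-tree (step e w@(stop _))   = grow (walk-tree w) (inj₂ (here e))
  walk-tree (step e w@(step _ _)) = grow (walk-tree w) (inj₂ (here e))

  tree-reach : ∀ {xs} → Tree xs → ∀ {x y} → x ∈ xs → y ∈ xs → Reach (_∈ xs) x y
  tree-reach (grow {a} {xs} T att) = go
    where
    weaken : ∀ {x y} → Reach (_∈ xs) x y → Reach (_∈ a ∷ xs) x y
    weaken (ys , w , ps) = ys , w , All.map there ps
    from-new : ∀ {y} → y ∈ xs → Attached a xs → Reach (_∈ a ∷ xs) a y
    from-new y∈xs (inj₁ refl) = contradiction y∈xs λ ()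
    from-new y∈xs (inj₂ adj)  =
      let c , c∈xs , e = find adj
          ys , w , ps  = weaken (tree-reach T c∈xs y∈xs)
      in a ∷ ys , step e w , here refl ∷ ps
    go : ∀ {x y} → x ∈ a ∷ xs → y ∈ a ∷ xs → Reach (_∈ a ∷ xs) x y
    go (here refl)  (here refl)  = _ , stop a , here refl ∷ []
    go (here refl)  (there y∈xs) = from-new y∈xs att
    go (there x∈xs) (here refl)  = reach-sym (from-new x∈xs att)
    go (there x∈xs) (there y∈xs) = weaken (tree-reach T x∈xs y∈xs)

  treeDecomposition : ∀ {xs} → Tree xs → Decomposition G
  treeDecomposition {xs} T = record { label = collapse xs ; blockConnected = connected }
    where
    connected : ∀ a b → collapse xs a ≡ collapse xs b →
      ∃[ ys ] (Path G a b ys × All (λ w → collapse xs w ≡ collapse xs a) ys)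
    connected a b eq with collapse-≡ xs eq
    ... | inj₂ refl = _ , (stop a , [] ∷ []) , refl ∷ []
    ... | inj₁ (a∈xs , b∈xs) =
      let ys , π , ps = reach⇒path (tree-reach T a∈xs b∈xs)
      in ys , π , All.map (λ w∈xs → collapse-∈ w∈xs a∈xs) ps

  lmcVec-tree : ∀ {xs} (T : Tree xs) c → lmcVec (treeDecomposition T) c ≡ blockVec (mem xs) c
  lmcVec-tree {xs} T ((a , b) , a<b) = go (a ∈? xs) (b ∈? xs)
    where
    d = treeDecomposition T
    go : Dec (a ∈ xs) → Dec (b ∈ xs) → lmcVec d ((a , b) , a<b) ≡ 1ℚ - mem xs a * mem xs b
    go (yes a∈xs) (yes b∈xs) = trans (lmcVec-together d a<b (collapse-∈ a∈xs b∈xs))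
      (sym (cong₂ (λ p q → 1ℚ - p * q) (mem-∈ a∈xs) (mem-∈ b∈xs)))
    go (no a∉xs)  _          = trans
      (lmcVec-apart d a<b λ eq → [ a∉xs ∘ proj₁ , <⇒≢ a<b ]′ (collapse-≡ xs eq))
      (sym (trans (cong (λ p → 1ℚ - p * mem xs b) (mem-∉ a∉xs)) (cong (λ p → 1ℚ - p) (*-zeroˡ (mem xs b)))))
    go _          (no b∉xs)  = trans
      (lmcVec-apart d a<b λ eq → [ b∉xs ∘ proj₂ , <⇒≢ a<b ]′ (collapse-≡ xs eq))
      (sym (trans (cong (λ p → 1ℚ - mem xs a * p) (mem-∉ b∉xs)) (cong (λ p → 1ℚ - p) (*-zeroʳ (mem xs a)))))

  -- Points of `LMC(G)` and convexity

  InLMC-cong : ∀ {x y} → (∀ c → x c ≡ y c) → InLMC G x → InLMC G y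
  InLMC-cong x≡y (k , d , μ , μ≥0 , Σμ≡1 , eq) =
    k , d , μ , μ≥0 , Σμ≡1 , λ c → trans (sym (x≡y c)) (eq c)

  InLMC-lmcVec : ∀ d → InLMC G (lmcVec d)
  InLMC-lmcVec d = 1 , (λ _ → d) , (λ _ → 1ℚ) , (λ _ → 0≤1) , refl ,
    λ c → sym (trans (+-identityʳ _) (*-identityˡ _))
    where
    0≤1 : 0ℚ ≤ 1ℚ
    0≤1 = nonNegative⁻¹ 1ℚ

  InLMC-tree : ∀ {xs} → Tree xs → InLMC G (blockVec (mem xs))
  InLMC-tree T = InLMC-cong (lmcVec-tree T) (InLMC-lmcVec (treeDecomposition T))

  InLMC-mid : ∀ {x y} → InLMC G x → InLMC G y → InLMC G (mid x y)
  InLMC-mid {x} {y} (k , d , μ , μ≥0 , Σμ≡1 , x-eq) (l , d′ , ν , ν≥0 , Σν≡1 , y-eq) =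
    k +ℕ l , proj₁ ∘ term , proj₂ ∘ term , nonNeg , total , combination
    where
    left : Fin k → Decomposition G × ℚ
    left i = d i , ½ * μ i
    right : Fin l → Decomposition G × ℚ
    right i = d′ i , ½ * ν i
    term : Fin (k +ℕ l) → Decomposition G × ℚ
    term = [ left , right ]′ ∘ splitAt k
    nonNeg : ∀ i → 0ℚ ≤ proj₂ (term i)
    nonNeg i with splitAt k i
    ... | inj₁ j = *-monoˡ-≤-nonNeg ½ (μ≥0 j)
    ... | inj₂ j = *-monoˡ-≤-nonNeg ½ (ν≥0 j)
    total : sumFin (k +ℕ l) (proj₂ ∘ term) ≡ 1ℚ
    total = trans (sum-splitAt k l left right proj₂) (cong₂ _+_
      (trans (sum-*ˡ k ½ μ) (cong (½ *_) Σμ≡1)) (trans (sum-*ˡ l ½ ν) (cong (½ *_) Σν≡1)))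
    halve : ∀ m (e : Fin m → Decomposition G) (ξ : Fin m → ℚ) c →
      sumFin m (λ i → ½ * ξ i * lmcVec (e i) c) ≡ ½ * sumFin m (λ i → ξ i * lmcVec (e i) c)
    halve m e ξ c = trans (sum-cong m λ i → *-assoc ½ (ξ i) (lmcVec (e i) c))
      (sum-*ˡ m ½ λ i → ξ i * lmcVec (e i) c)
    combination : ∀ c → mid x y c ≡ sumFin (k +ℕ l) (λ i → proj₂ (term i) * lmcVec (proj₁ (term i)) c)
    combination c = sym (begin
      sumFin (k +ℕ l) (h ∘ term)
        ≡⟨ sum-splitAt k l left right h ⟩
      sumFin k (h ∘ left) + sumFin l (h ∘ right)
        ≡⟨ cong₂ _+_ (trans (halve k d μ c) (cong (½ *_) (sym (x-eq c))))
                     (trans (halve l d′ ν c) (cong (½ *_) (sym (y-eq c)))) ⟩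
      ½ * x c + ½ * y c
        ≡⟨ *-distribˡ-+ ½ (x c) (y c) ⟨
      mid x y c ∎)
      where
      open ≡-Reasoning
      h : Decomposition G × ℚ → ℚ
      h (e , r) = r * lmcVec e c

  -- Interiors of paths between two vertex sets

  Link : Fin n → Fin n → List (Fin n) → Set
  Link s t I = (I ≡ [] × Edge G s t) ⊎ (Any (Edge G s) I × Any (Edge G t) I)

  link-sym : ∀ {s t I} → Link s t I → Link t s I
  link-sym (inj₁ (I≡[] , e)) = inj₁ (I≡[] , edge-sym e)
  link-sym (inj₂ (s~I , t~I)) = inj₂ (t~I , s~I)

  link-attached : ∀ {s t I} → Link s t I → Attached s I
  link-attached (inj₁ (I≡[] , _)) = inj₁ I≡[]
  link-attached (inj₂ (s~I , _))  = inj₂ s~I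

  -- For an empty interior the edge `st` stored in `Link` is what connects the two ends.
  link-attached-∷ : ∀ {s t I} → Link s t I → Attached s (t ∷ I)
  link-attached-∷ (inj₁ (_ , e))   = inj₂ (here e)
  link-attached-∷ (inj₂ (s~I , _)) = inj₂ (there s~I)

  module _ {A B : Fin n → Set} (A? : Decidable A) (B? : Decidable B) where

    record Interior (s t : Fin n) : Set where
      field
        inner : List (Fin n)
        tree  : Tree inner
        link  : Link s t inner
        avoid : All (λ w → ¬ A w × ¬ B w) inner

    private
      Crossing : Set
      Crossing = ∃[ s ] ∃[ t ] A s × B t × Interior s t

      Pending : Fin n → Set
      Pending a = ¬ A a × ∃[ t ] ¬ B a × B t × Interior a t

      -- The walk is read from its end. Either the current vertex lies in `B` and can close a new
      -- stretch, or a stretch from `A` to `B` is already found, or the stretch up to the next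
      -- vertex of `B` is still waiting for a vertex of `A`.
      scan : ∀ {a b xs} → Walk G a b xs → B b → B a ⊎ Crossing ⊎ Pending a
      scan (stop _) Bb = inj₁ Bb
      scan {a} (step {c = c} e w) Bb with B? a | scan w Bb
      ... | yes Ba | _              = inj₁ Ba
      ... | no _   | inj₂ (inj₁ X)  = inj₂ (inj₁ X)
      ... | no ¬Ba | inj₁ Bc        = inj₂ (settle c Bc record
        { inner = [] ; tree = nil ; link = inj₁ (refl , e) ; avoid = [] })
        where
        settle : ∀ t → B t → Interior a t → Crossing ⊎ Pending a
        settle t Bt I with A? a
        ... | yes Aa = inj₁ (a , t , Aa , Bt , I)
        ... | no ¬Aa = inj₂ (¬Aa , t , ¬Ba , Bt , I)
      ... | no ¬Ba | inj₂ (inj₂ (¬Ac , t , ¬Bc , Bt , I)) = inj₂ (settle record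
        { inner = c ∷ I.inner
        ; tree  = grow I.tree (link-attached I.link)
        ; link  = inj₂ (here e , extend I.link)
        ; avoid = (¬Ac , ¬Bc) ∷ I.avoid })
        where
        module I = Interior I
        extend : ∀ {J} → Link c t J → Any (Edge G t) (c ∷ J)
        extend (inj₁ (_ , c~t)) = here (edge-sym c~t)
        extend (inj₂ (_ , t~J)) = there t~J
        settle : Interior a t → Crossing ⊎ Pending a
        settle J with A? a
        ... | yes Aa = inj₁ (a , t , Aa , Bt , J)
        ... | no ¬Aa = inj₂ (¬Aa , t , ¬Ba , Bt , J)

    -- A start in `A` but outside `B` leaves only one outcome of `scan`. With singletons this yields
    -- the interior of an `ab`-path; with `{u, u′}` and `{v, v′}` it decides which terminals are
    -- joined.
    crossing : ∀ {a b xs} → Walk G a b xs → A a → ¬ B a → B b →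
      ∃[ s ] ∃[ t ] A s × B t × Interior s t
    crossing w Aa ¬Ba Bb with scan w Bb
    ... | inj₁ Ba              = contradiction Ba ¬Ba
    ... | inj₂ (inj₁ X)        = X
    ... | inj₂ (inj₂ (¬Aa , _)) = contradiction Aa ¬Aa

-- Enumeration of the pairs of vertices

IsPair : ∀ {n} → Coord n → Fin n → Fin n → Set
IsPair c a b = proj₁ c ≡ (a , b) ⊎ proj₁ c ≡ (b , a)

isPair-unique : ∀ {n} {c c′ : Coord n} {a b} → IsPair c a b → IsPair c′ a b → c ≡ c′
isPair-unique (inj₁ refl) (inj₁ refl) = coord-≡ refl
isPair-unique (inj₂ refl) (inj₂ refl) = coord-≡ refl
isPair-unique {c = _ , a<b} {_ , b<a} (inj₁ refl) (inj₂ refl) = contradiction b<a (<-asym a<b)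
isPair-unique {c = _ , b<a} {_ , a<b} (inj₂ refl) (inj₁ refl) = contradiction b<a (<-asym a<b)

isPair-≢ : ∀ {n} {c c′ : Coord n} {a b a′ b′} → IsPair c a b → IsPair c′ a′ b′ →
  a ≢ a′ ⊎ b ≢ b′ → a ≢ b′ ⊎ b ≢ a′ → c ≢ c′
isPair-≢ (inj₁ refl) (inj₁ refl) ne _ refl = [ (λ f → f refl) , (λ f → f refl) ]′ ne
isPair-≢ (inj₂ refl) (inj₂ refl) ne _ refl = [ (λ f → f refl) , (λ f → f refl) ]′ ne
isPair-≢ (inj₁ refl) (inj₂ refl) _ ne refl = [ (λ f → f refl) , (λ f → f refl) ]′ ne
isPair-≢ (inj₂ refl) (inj₁ refl) _ ne refl = [ (λ f → f refl) , (λ f → f refl) ]′ ne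

E-isPair : ∀ {n} {c : Coord n} {a b} → IsPair c a b → E a b c ≡ 1ℚ
E-isPair {c = _ , a<b} (inj₁ refl) = E-same a<b
E-isPair {c = c@(_ , b<a)} {a} {b} (inj₂ refl) = trans (E-comm a b c) (E-same b<a)

E-¬isPair : ∀ {n} {c : Coord n} {a b} → ¬ IsPair c a b → E a b c ≡ 0ℚ
E-¬isPair {c = c} c≢ab = E-other c (c≢ab ∘ inj₁) (c≢ab ∘ inj₂)

E-of : ∀ {n} → Coord n → Vect n
E-of ((a , b) , _) = E a b

unique⇒lookup-injective : ∀ {A : Set} {xs : List A} → Unique xs → ∀ i j → lookup xs i ≡ lookup xs j → i ≡ j
unique⇒lookup-injective (_ ∷ _)    zero    zero    _  = refl
unique⇒lookup-injective (x≢ ∷ _)   zero    (suc j) eq = contradiction eq (All.lookup x≢ (∈-lookup j))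
unique⇒lookup-injective (x≢ ∷ _)   (suc i) zero    eq = contradiction (sym eq) (All.lookup x≢ (∈-lookup i))
unique⇒lookup-injective (_ ∷ uniq) (suc i) (suc j) eq = cong suc (unique⇒lookup-injective uniq i j eq)

coord≟ : ∀ {n} (c c′ : Coord n) → Dec (c ≡ c′)
coord≟ c c′ with ≡-dec _≟ᶠ_ _≟ᶠ_ (proj₁ c) (proj₁ c′)
... | yes eq = yes (coord-≡ eq)
... | no neq = no (neq ∘ cong proj₁)

-- With `c₀` set apart, one enumeration serves both ranks: `all` has `R + 1` coordinates and is used
-- for `LMC(G)`, while `others` has `R` and is used for the face.
module Coordinates {n} (c₀ : Coord n) where

  private
    Other : Fin n × Fin n → Set
    Other p = proj₁ p < proj₂ p × p ≢ proj₁ c₀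

    other? : Decidable Other
    other? p = (proj₁ p <? proj₂ p) ×-dec ¬? (≡-dec _≟ᶠ_ _≟ᶠ_ p (proj₁ c₀))

    pairs : List (Fin n × Fin n)
    pairs = filter other? (cartesianProduct (allFin n) (allFin n))

    isOther : ∀ i → Other (lookup pairs i)
    isOther i = All.lookup (all-filter other? (cartesianProduct (allFin n) (allFin n))) (∈-lookup i)

  R : ℕ
  R = length pairs

  others : Fin R → Coord n
  others i = lookup pairs i , proj₁ (isOther i)

  others-≢ : ∀ i → others i ≢ c₀
  others-≢ i eq = proj₂ (isOther i) (cong proj₁ eq)

  others-injective : ∀ i j → others i ≡ others j → i ≡ j
  others-injective i j eq = unique⇒lookup-injective
    (filter⁺ other? (cartesianProduct⁺ (allFin⁺ n) (allFin⁺ n))) i j (cong proj₁ eq)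

  others-complete : ∀ c → c ≢ c₀ → ∃[ i ] others i ≡ c
  others-complete c@((a , b) , a<b) c≢c₀ = index c∈pairs , coord-≡ (sym (lookup-index c∈pairs))
    where
    c∈pairs : (a , b) ∈ pairs
    c∈pairs = ∈-filter⁺ other? (∈-cartesianProduct⁺ (∈-allFin a) (∈-allFin b)) (a<b , c≢c₀ ∘ coord-≡)

  all : Fin (suc R) → Coord n
  all zero    = c₀
  all (suc i) = others i

  all-injective : ∀ i j → all i ≡ all j → i ≡ j
  all-injective zero    zero    _  = refl
  all-injective zero    (suc j) eq = contradiction (sym eq) (others-≢ j)
  all-injective (suc i) zero    eq = contradiction eq (others-≢ i)
  all-injective (suc i) (suc j) eq = cong suc (others-injective i j eq)

  all-complete : ∀ c → ∃[ i ] all i ≡ c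
  all-complete c with coord≟ c c₀
  ... | yes c≡c₀ = zero , sym c≡c₀
  ... | no c≢c₀  = let i , eq = others-complete c c≢c₀ in suc i , eq

E-of-δ : ∀ {n R} (cs : Fin R → Coord n) → (∀ i j → cs i ≡ cs j → i ≡ j) →
  ∀ i j → E-of (cs i) (cs j) ≡ δ i j
E-of-δ cs injective i j with i ≟ᶠ j
... | yes refl = E-isPair {c = cs i} (inj₁ refl)
... | no i≢j   = E-¬isPair {c = cs j} λ p → i≢j (injective i j (isPair-unique (inj₁ refl) p))

-- Differences of points as combinations of blocks

record Shift {n} (K : Vect n → Set) (t : Vect n) : Set where
  constructor shift
  field
    {from to} : Vect n
    from∈K    : K from
    to∈K      : K to
    scale     : ℚ
    scale≢0   : scale ≢ 0ℚ
    to-from   : ∀ c → to c ≡ from c + scale * t c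

-- Restriction to `cs` is where a surplus multiple of `E u v` may disappear, so `t` has to agree
-- with `s` only there.
shift⇒direction : ∀ {n R} {K : Vect n → Set} {cs : Fin R → Coord n} {t s} → Shift K t →
  (∀ j → t (cs j) ≡ s j) → AffineRank.Direction {K = K} cs s
shift⇒direction {cs = cs} (shift {from} p∈K q∈K κ κ≢0 eq) t≡s = AffineRank.direction p∈K q∈K κ κ≢0
  λ j → trans (eq (cs j)) (cong (λ y → from (cs j) + κ * y) (t≡s j))

module _ {n} {K : Vect n → Set} (K-mid : ∀ {x y} → K x → K y → K (mid x y)) where

  -- Inclusion–exclusion over the blocks h, f + h, g + h, f + g + h isolates the pairs
  -- with one end in f and the other in g.
  shift-cross : ∀ (f g h fh gh fgh : Fin n → ℚ) →
    (∀ w → fh w ≡ f w + h w) → (∀ w → gh w ≡ g w + h w) → (∀ w → fgh w ≡ f w + (g w + h w)) →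
    K (blockVec h) → K (blockVec fh) → K (blockVec gh) → K (blockVec fgh) → Shift K (cross f g)
  shift-cross f g h fh gh fgh fh-eq gh-eq fgh-eq Kh Kfh Kgh Kfgh =
    -- `blockVec` contains the product with a minus sign, so the positive terms of the
    -- inclusion-exclusion make up the starting point. Averaging two blocks gives the factor `½`.
    shift (K-mid Kfgh Kh) (K-mid Kfh Kgh) ½ (λ ()) identity
    where
    identity : ∀ c → mid (blockVec fh) (blockVec gh) c
      ≡ mid (blockVec fgh) (blockVec h) c + ½ * cross f g c
    identity ((w , w′) , _) rewrite fh-eq w | fh-eq w′ | gh-eq w | gh-eq w′ | fgh-eq w | fgh-eq w′ =
      solve 7 (λ k f f′ g g′ h h′ →
          k :* ((con 1ℚ :- (f :+ h) :* (f′ :+ h′)) :+ (con 1ℚ :- (g :+ h) :* (g′ :+ h′)))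
        := k :* ((con 1ℚ :- (f :+ (g :+ h)) :* (f′ :+ (g′ :+ h′))) :+ (con 1ℚ :- h :* h′))
          :+ k :* (f :* g′ :+ g :* f′)) refl
        ½ (f w) (f w′) (g w) (g w′) (h w) (h w′)

  -- The difference of two inclusion-exclusions: `f′`, `g′` over `f + g + h`, and `f`, `g` over `h`.
  -- The block `f + g + h` cancels, which is the point: for the block `I` with `u` and `v` added it
  -- lies off the face.
  shift-exchange : ∀ (f f′ g g′ h fh gh fgg′h f′fgh all : Fin n → ℚ) →
    (∀ w → fh w ≡ f w + h w) → (∀ w → gh w ≡ g w + h w) →
    (∀ w → fgg′h w ≡ g′ w + (f w + (g w + h w))) → (∀ w → f′fgh w ≡ f′ w + (f w + (g w + h w))) →
    (∀ w → all w ≡ g′ w + (f′ w + (f w + (g w + h w)))) →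
    K (blockVec h) → K (blockVec fh) → K (blockVec gh) → K (blockVec fgg′h) →
    K (blockVec f′fgh) → K (blockVec all) → Shift K (λ c → cross f′ g′ c - cross f g c)
  shift-exchange f f′ g g′ h fh gh fgg′h f′fgh all e₁ e₂ e₃ e₄ e₅ Kh Kfh Kgh Kfgg′h Kf′fgh Kall =
    -- The block `h` pads both sides to four points, so that nested midpoints weigh all of them
    -- equally; hence the factor `½ * ½`.
    shift (K-mid (K-mid Kall Kfh) (K-mid Kgh Kh)) (K-mid (K-mid Kfgg′h Kf′fgh) (K-mid Kh Kh))
      (½ * ½) (λ ()) identity
    where
    identity : ∀ c → mid (mid (blockVec fgg′h) (blockVec f′fgh)) (mid (blockVec h) (blockVec h)) c
      ≡ mid (mid (blockVec all) (blockVec fh)) (mid (blockVec gh) (blockVec h)) c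
        + ½ * ½ * (cross f′ g′ c - cross f g c)
    identity ((w , w′) , _) rewrite e₁ w | e₁ w′ | e₂ w | e₂ w′ | e₃ w | e₃ w′ | e₄ w | e₄ w′ | e₅ w | e₅ w′ =
      solve 11 (λ k f F f′ F′ g G g′ G′ h H →
          k :* (k :* ((con 1ℚ :- (g′ :+ (f :+ (g :+ h))) :* (G′ :+ (F :+ (G :+ H))))
                     :+ (con 1ℚ :- (f′ :+ (f :+ (g :+ h))) :* (F′ :+ (F :+ (G :+ H)))))
             :+ k :* ((con 1ℚ :- h :* H) :+ (con 1ℚ :- h :* H)))
        := k :* (k :* ((con 1ℚ :- (g′ :+ (f′ :+ (f :+ (g :+ h)))) :* (G′ :+ (F′ :+ (F :+ (G :+ H)))))
                     :+ (con 1ℚ :- (f :+ h) :* (F :+ H)))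
             :+ k :* ((con 1ℚ :- (g :+ h) :* (G :+ H)) :+ (con 1ℚ :- h :* H)))
           :+ k :* k :* ((f′ :* G′ :+ g′ :* F′) :- (f :* G :+ g :* F))) refl
        ½ (f w) (f w′) (f′ w) (f′ w′) (g w) (g w′) (g′ w) (g′ w′) (h w) (h w′)

-- The dimension of `LMC(G)`

module _ {n} (G : Graph n) where

  record Span (a b : Fin n) : Set where
    constructor span
    field
      {inner} : List (Fin n)
      tree    : Tree G inner
      link    : Link G a b inner
      start∉  : a ∉ inner
      end∉    : b ∉ inner

  connected⇒span : Connected G → ∀ {a b} → a ≢ b → Span a b
  connected⇒span conn {a} {b} a≢b with crossing G (_≟ᶠ a) (_≟ᶠ b) (proj₁ (proj₂ (conn a b))) refl a≢b refl
  ... | _ , _ , refl , refl , I = span tree link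
      (λ a∈I → proj₁ (All.lookup avoid a∈I) refl) (λ b∈I → proj₂ (All.lookup avoid b∈I) refl)
    where open Interior I

  -- Adds s or s′ to the inner vertices when exactly one of them is already there.
  balance : ∀ {s s′ a b} → Edge G s s′ → a ≢ s → a ≢ s′ → b ≢ s → b ≢ s′ → Span a b →
    Σ (Span a b) λ S → mem (Span.inner S) s ≡ mem (Span.inner S) s′
  balance {s} {s′} {a} {b} e a≢s a≢s′ b≢s b≢s′ S@(span {I} tree link a∉I b∉I) = go (s ∈? I) (s′ ∈? I)
    where
    extend : ∀ {x} → Any (Edge G x) I → a ≢ x → b ≢ x → Span a b
    extend {x} x~I a≢x b≢x = span (grow tree (inj₂ x~I)) (weaken link)
      (λ { (here a≡x) → a≢x a≡x ; (there a∈I) → a∉I a∈I })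
      (λ { (here b≡x) → b≢x b≡x ; (there b∈I) → b∉I b∈I })
      where
      weaken : Link G a b I → Link G a b (x ∷ I)
      -- A neighbour of `x` in `I` excludes the empty interior.
      weaken (inj₁ (refl , _))   = contradiction x~I λ ()
      weaken (inj₂ (a~I , b~I)) = inj₂ (there a~I , there b~I)
    go : Dec (s ∈ I) → Dec (s′ ∈ I) → Σ (Span a b) λ S → mem (Span.inner S) s ≡ mem (Span.inner S) s′
    go (yes s∈I) (yes s′∈I) = S , trans (mem-∈ s∈I) (sym (mem-∈ s′∈I))
    go (no s∉I)  (no s′∉I)  = S , trans (mem-∉ s∉I) (sym (mem-∉ s′∉I))
    go (yes s∈I) (no _)     = extend (Any.map (λ { refl → edge-sym G e }) s∈I) a≢s′ b≢s′
      , trans (mem-∈ {xs = s′ ∷ I} (there s∈I)) (sym (mem-∈ {xs = s′ ∷ I} (here refl)))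
    go (no _)    (yes s′∈I) = extend (Any.map (λ { refl → e }) s′∈I) a≢s b≢s
      , trans (mem-∈ {xs = s ∷ I} (here refl)) (sym (mem-∈ {xs = s ∷ I} (there s′∈I)))

  module _ {K : Vect n → Set} (K-mid : ∀ {x y} → K x → K y → K (mid x y)) where

    -- The hypothesis asks for membership of just the four blocks of the inclusion-exclusion, so the
    -- same argument works in `LMC(G)` and on the face.
    shift-span : ∀ {a b} → a ≢ b → (S : Span a b) → let I = Span.inner S in
      (∀ {xs} → Tree G xs → xs ≡ I ⊎ xs ≡ a ∷ I ⊎ xs ≡ b ∷ I ⊎ xs ≡ a ∷ b ∷ I → K (blockVec (mem xs))) →
      Shift K (E a b)
    shift-span {a} {b} a≢b (span {I} tree link a∉I b∉I) tree∈K = shift-cross K-mid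
      (δ a) (δ b) (mem I) (mem (a ∷ I)) (mem (b ∷ I)) (mem (a ∷ b ∷ I))
      (mem-∷ a∉I) (mem-∷ b∉I)
      (λ w → trans (mem-∷ {xs = b ∷ I} a∉bI w) (cong (δ a w +_) (mem-∷ b∉I w)))
      (tree∈K tree (inj₁ refl))
      (tree∈K (grow tree (link-attached G link)) (inj₂ (inj₁ refl)))
      (tree∈K b∷tree (inj₂ (inj₂ (inj₁ refl))))
      (tree∈K (grow b∷tree (link-attached-∷ G link)) (inj₂ (inj₂ (inj₂ refl))))
      where
      b∷tree : Tree G (b ∷ I)
      b∷tree = grow tree (link-attached G (link-sym G link))
      a∉bI : a ∉ b ∷ I
      a∉bI (here a≡b)  = a≢b a≡b
      a∉bI (there a∈I) = a∉I a∈I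

  -- Connectedness provides a path for every pair, hence every unit vector as a direction: `R + 1`
  -- coordinates and one apex.
  rank-LMC : Connected G → ∀ c₀ → HasAffRank (InLMC G) (suc (suc (Coordinates.R c₀)))
  rank-LMC conn c₀ = simplex (InLMC-mid G) (InLMC-tree G nil) directions , rank-≤ determined
    where
    open Coordinates c₀
    open AffineRank {K = InLMC G} all
    directions : ∀ i → Direction (δ i)
    directions i = shift⇒direction
      (shift-span (InLMC-mid G) a≢b (connected⇒span conn a≢b) λ T _ → InLMC-tree G T)
      (E-of-δ all all-injective i)
      where a≢b = <⇒≢ (proj₂ (all i))
    determined : Determined
    determined m p _ μ _ vanish c with all-complete c
    ... | j , refl = vanish j

  -- Points on the face

  module _ (u u′ v v′ : Fin n) where

    Face-mid : ∀ {x y} → u ≢ v → u′ ≢ v′ → u ≢ v′ → v ≢ u′ →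
      Face G (ineq u u′ v v′) x → Face G (ineq u u′ v v′) y → Face G (ineq u u′ v v′) (mid x y)
    Face-mid {x} {y} u≢v u′≢v′ u≢v′ v≢u′ (x∈ , x-eq) (y∈ , y-eq) = InLMC-mid G x∈ y∈ , (begin
      at (mid x y) u v + at (mid x y) u′ v′
        ≡⟨ cong₂ _+_ (at-mid u≢v) (at-mid u′≢v′) ⟩
      ½ * (at x u v + at y u v) + ½ * (at x u′ v′ + at y u′ v′)
        ≡⟨ regroup (at x u v) (at y u v) (at x u′ v′) (at y u′ v′) ⟩
      ½ * ((at x u v + at x u′ v′) + (at y u v + at y u′ v′))
        ≡⟨ cong₂ (λ p q → ½ * (p + q)) x-eq y-eq ⟩
      ½ * ((at x u v′ + at x v u′) + (at y u v′ + at y v u′))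
        ≡⟨ regroup (at x u v′) (at y u v′) (at x v u′) (at y v u′) ⟨
      ½ * (at x u v′ + at y u v′) + ½ * (at x v u′ + at y v u′)
        ≡⟨ cong₂ _+_ (at-mid u≢v′) (at-mid v≢u′) ⟨
      at (mid x y) u v′ + at (mid x y) v u′ ∎)
      where
      open ≡-Reasoning
      at-mid : ∀ {a b} → a ≢ b → at (mid x y) a b ≡ ½ * (at x a b + at y a b)
      at-mid a≢b with at-coord a≢b
      ... | c , _ , eq = trans (eq (mid x y)) (sym (cong₂ (λ p q → ½ * (p + q)) (eq x) (eq y)))
      regroup : ∀ p q r s → ½ * (p + q) + ½ * (r + s) ≡ ½ * ((p + r) + (q + s))
      regroup = solve 4 (λ p q r s → con ½ :* (p :+ q) :+ con ½ :* (r :+ s) := con ½ :* ((p :+ r) :+ (q :+ s))) refl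

    data Balanced (xs : List (Fin n)) : Set where
      agree-u : mem xs u ≡ mem xs u′ → Balanced xs
      agree-v : mem xs v ≡ mem xs v′ → Balanced xs

    -- On `blockVec f` the right side exceeds the left by `(f u - f u′) * (f v - f v′)`, and either
    -- form of `Balanced` makes one factor zero.
    Face-tree : u ≢ v → u′ ≢ v′ → u ≢ v′ → v ≢ u′ →
      ∀ {xs} → Tree G xs → Balanced xs → Face G (ineq u u′ v v′) (blockVec (mem xs))
    Face-tree u≢v u′≢v′ u≢v′ v≢u′ {xs} T bal = InLMC-tree G T , (begin
      at x u v + at x u′ v′
        ≡⟨ cong₂ _+_ (at-blockVec f u≢v) (at-blockVec f u′≢v′) ⟩
      (1ℚ - f u * f v) + (1ℚ - f u′ * f v′)
        ≡⟨ balanced bal ⟩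
      (1ℚ - f u * f v′) + (1ℚ - f v * f u′)
        ≡⟨ cong₂ _+_ (at-blockVec f u≢v′) (at-blockVec f v≢u′) ⟨
      at x u v′ + at x v u′ ∎)
      where
      open ≡-Reasoning
      f = mem xs
      x = blockVec f
      balanced : Balanced xs → (1ℚ - f u * f v) + (1ℚ - f u′ * f v′) ≡ (1ℚ - f u * f v′) + (1ℚ - f v * f u′)
      balanced (agree-u eq) rewrite eq = solve 3
        (λ p q r → (con 1ℚ :- p :* q) :+ (con 1ℚ :- p :* r) := (con 1ℚ :- p :* r) :+ (con 1ℚ :- q :* p)) refl
        (f u′) (f v) (f v′)
      balanced (agree-v eq) rewrite eq = solve 3
        (λ p q r → (con 1ℚ :- p :* q) :+ (con 1ℚ :- r :* q) := (con 1ℚ :- p :* q) :+ (con 1ℚ :- q :* r)) refl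
        (f u) (f v′) (f u′)

-- The rank of the face, given a `uv`-path whose interior avoids all four terminals

module FaceRank {n} (G : Graph n) (conn : Connected G) (u u′ v v′ : Fin n)
  (u~u′ : Edge G u u′) (v~v′ : Edge G v v′)
  (u≢u′ : u ≢ u′) (u≢v : u ≢ v) (u≢v′ : u ≢ v′) (u′≢v : u′ ≢ v) (u′≢v′ : u′ ≢ v′) (v≢v′ : v ≢ v′)
  {I : List (Fin n)} (tree : Tree G I) (link : Link G u v I)
  (u∉I : u ∉ I) (u′∉I : u′ ∉ I) (v∉I : v ∉ I) (v′∉I : v′ ∉ I) where

  private
    F : Vect n → Set
    F = Face G (ineq u u′ v v′)

    F-mid : ∀ {x y} → F x → F y → F (mid x y)
    F-mid = Face-mid G u u′ v v′ u≢v u′≢v′ u≢v′ (≢-sym u′≢v)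

    F-tree : ∀ {xs} → Tree G xs → Balanced G u u′ v v′ xs → F (blockVec (mem xs))
    F-tree = Face-tree G u u′ v v′ u≢v u′≢v′ u≢v′ (≢-sym u′≢v)

    both-u : ∀ {xs} → u ∈ xs → u′ ∈ xs → Balanced G u u′ v v′ xs
    both-u u∈ u′∈ = agree-u (trans (mem-∈ u∈) (sym (mem-∈ u′∈)))

    both-v : ∀ {xs} → v ∈ xs → v′ ∈ xs → Balanced G u u′ v v′ xs
    both-v v∈ v′∈ = agree-v (trans (mem-∈ v∈) (sym (mem-∈ v′∈)))

    neither-u : ∀ {xs} → u ∉ xs → u′ ∉ xs → Balanced G u u′ v v′ xs
    neither-u u∉ u′∉ = agree-u (trans (mem-∉ u∉) (sym (mem-∉ u′∉)))

    neither-v : ∀ {xs} → v ∉ xs → v′ ∉ xs → Balanced G u u′ v v′ xs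
    neither-v v∉ v′∉ = agree-v (trans (mem-∉ v∉) (sym (mem-∉ v′∉)))

    ∉-∷ : ∀ {x y} {xs : List (Fin n)} → x ≢ y → x ∉ xs → x ∉ y ∷ xs
    ∉-∷ x≢y _    (here x≡y)   = x≢y x≡y
    ∉-∷ _   x∉xs (there x∈xs) = x∉xs x∈xs

    uI : Tree G (u ∷ I)
    uI = grow tree (link-attached G link)
    vI : Tree G (v ∷ I)
    vI = grow tree (link-attached G (link-sym G link))
    uvI : Tree G (u ∷ v ∷ I)
    uvI = grow vI (link-attached-∷ G link)
    u′uI : Tree G (u′ ∷ u ∷ I)
    u′uI = grow uI (inj₂ (here (edge-sym G u~u′)))
    v′vI : Tree G (v′ ∷ v ∷ I)
    v′vI = grow vI (inj₂ (here (edge-sym G v~v′)))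
    u′uvI : Tree G (u′ ∷ u ∷ v ∷ I)
    u′uvI = grow uvI (inj₂ (here (edge-sym G u~u′)))
    v′uvI : Tree G (v′ ∷ u ∷ v ∷ I)
    v′uvI = grow uvI (inj₂ (there (here (edge-sym G v~v′))))
    v′u′uvI : Tree G (v′ ∷ u′ ∷ u ∷ v ∷ I)
    v′u′uvI = grow u′uvI (inj₂ (there (there (here (edge-sym G v~v′)))))

    -- The block `u ∷ v ∷ I` is absent from this list because it lies off the face; it is only a
    -- stage in building larger trees.
    F-I : F (blockVec (mem I))
    F-I = F-tree tree (neither-u u∉I u′∉I)
    F-uI : F (blockVec (mem (u ∷ I)))
    F-uI = F-tree uI (neither-v (∉-∷ (≢-sym u≢v) v∉I) (∉-∷ (≢-sym u≢v′) v′∉I))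
    F-vI : F (blockVec (mem (v ∷ I)))
    F-vI = F-tree vI (neither-u (∉-∷ u≢v u∉I) (∉-∷ u′≢v u′∉I))
    F-u′uI : F (blockVec (mem (u′ ∷ u ∷ I)))
    F-u′uI = F-tree u′uI (both-u (there (here refl)) (here refl))
    F-v′vI : F (blockVec (mem (v′ ∷ v ∷ I)))
    F-v′vI = F-tree v′vI (both-v (there (here refl)) (here refl))
    F-u′uvI : F (blockVec (mem (u′ ∷ u ∷ v ∷ I)))
    F-u′uvI = F-tree u′uvI (both-u (there (here refl)) (here refl))
    F-v′uvI : F (blockVec (mem (v′ ∷ u ∷ v ∷ I)))
    F-v′uvI = F-tree v′uvI (both-v (there (there (here refl))) (here refl))
    F-v′u′uvI : F (blockVec (mem (v′ ∷ u′ ∷ u ∷ v ∷ I)))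
    F-v′u′uvI = F-tree v′u′uvI (both-u (there (there (here refl))) (there (here refl)))

    mem-uv : ∀ w → mem (u ∷ v ∷ I) w ≡ δ u w + (δ v w + mem I w)
    mem-uv w = trans (mem-∷ (∉-∷ u≢v u∉I) w) (cong (δ u w +_) (mem-∷ v∉I w))
    mem-u′u : ∀ w → mem (u′ ∷ u ∷ I) w ≡ δ u′ w + (δ u w + mem I w)
    mem-u′u w = trans (mem-∷ (∉-∷ (≢-sym u≢u′) u′∉I) w) (cong (δ u′ w +_) (mem-∷ u∉I w))
    mem-v′v : ∀ w → mem (v′ ∷ v ∷ I) w ≡ δ v′ w + (δ v w + mem I w)
    mem-v′v w = trans (mem-∷ (∉-∷ (≢-sym v≢v′) v′∉I) w) (cong (δ v′ w +_) (mem-∷ v∉I w))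
    mem-u′uv : ∀ w → mem (u′ ∷ u ∷ v ∷ I) w ≡ δ u′ w + (δ u w + (δ v w + mem I w))
    mem-u′uv w = trans (mem-∷ (∉-∷ (≢-sym u≢u′) (∉-∷ u′≢v u′∉I)) w) (cong (δ u′ w +_) (mem-uv w))
    mem-v′uv : ∀ w → mem (v′ ∷ u ∷ v ∷ I) w ≡ δ v′ w + (δ u w + (δ v w + mem I w))
    mem-v′uv w = trans (mem-∷ (∉-∷ (≢-sym u≢v′) (∉-∷ (≢-sym v≢v′) v′∉I)) w) (cong (δ v′ w +_) (mem-uv w))
    mem-v′u′uv : ∀ w → mem (v′ ∷ u′ ∷ u ∷ v ∷ I) w ≡ δ v′ w + (δ u′ w + (δ u w + (δ v w + mem I w)))
    mem-v′u′uv w = trans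
      (mem-∷ (∉-∷ (≢-sym u′≢v′) (∉-∷ (≢-sym u≢v′) (∉-∷ (≢-sym v≢v′) v′∉I))) w)
      (cong (δ v′ w +_) (mem-u′uv w))

    -- Adding `v` and `v′` together keeps all four blocks on the face, at the price of the extra
    -- term `E u v`.
    shift-uv′ : Shift F (cross (δ u) (λ w → δ v w + δ v′ w))
    shift-uv′ = shift-cross F-mid (δ u) (λ w → δ v w + δ v′ w)
      (mem I) (mem (u ∷ I)) (mem (v′ ∷ v ∷ I)) (mem (v′ ∷ u ∷ v ∷ I))
      (mem-∷ u∉I)
      (λ w → trans (mem-v′v w) (solve 3 (λ p q r → p :+ (q :+ r) := q :+ p :+ r) refl (δ v′ w) (δ v w) (mem I w)))
      (λ w → trans (mem-v′uv w) (solve 4 (λ p a q r → p :+ (a :+ (q :+ r)) := a :+ (q :+ p :+ r)) refl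
        (δ v′ w) (δ u w) (δ v w) (mem I w)))
      F-I F-uI F-v′vI F-v′uvI

    shift-vu′ : Shift F (cross (δ v) (λ w → δ u w + δ u′ w))
    shift-vu′ = shift-cross F-mid (δ v) (λ w → δ u w + δ u′ w)
      (mem I) (mem (v ∷ I)) (mem (u′ ∷ u ∷ I)) (mem (u′ ∷ u ∷ v ∷ I))
      (mem-∷ v∉I)
      (λ w → trans (mem-u′u w) (solve 3 (λ p q r → p :+ (q :+ r) := q :+ p :+ r) refl (δ u′ w) (δ u w) (mem I w)))
      (λ w → trans (mem-u′uv w) (solve 4 (λ p q a r → p :+ (q :+ (a :+ r)) := a :+ (q :+ p :+ r)) refl
        (δ u′ w) (δ u w) (δ v w) (mem I w)))
      F-I F-vI F-u′uI F-u′uvI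

    shift-u′v′ : Shift F (λ c → E u′ v′ c - E u v c)
    shift-u′v′ = shift-exchange F-mid (δ u) (δ u′) (δ v) (δ v′)
      (mem I) (mem (u ∷ I)) (mem (v ∷ I)) (mem (v′ ∷ u ∷ v ∷ I)) (mem (u′ ∷ u ∷ v ∷ I)) (mem (v′ ∷ u′ ∷ u ∷ v ∷ I))
      (mem-∷ u∉I) (mem-∷ v∉I) mem-v′uv mem-u′uv mem-v′u′uv
      F-I F-uI F-vI F-v′uvI F-u′uvI F-v′u′uvI

    -- Once the interior treats `s` and `s′` alike, adding `a` or `b` preserves this, so all four
    -- blocks stay on the face.
    shift-clear : ∀ {s s′} → Edge G s s′ → (∀ {xs} → mem xs s ≡ mem xs s′ → Balanced G u u′ v v′ xs) →
      ∀ {a b} → a ≢ b → a ≢ s → a ≢ s′ → b ≢ s → b ≢ s′ → Shift F (E a b)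
    shift-clear {s} {s′} e agreed {a} {b} a≢b a≢s a≢s′ b≢s b≢s′
      with balance G e a≢s a≢s′ b≢s b≢s′ (connected⇒span G conn a≢b)
    ... | S , eq = shift-span G F-mid a≢b S λ T which → F-tree T (agreed (agree which))
      where
      J = Span.inner S
      skip : ∀ {x} xs → x ≢ s → x ≢ s′ → mem xs s ≡ mem xs s′ → mem (x ∷ xs) s ≡ mem (x ∷ xs) s′
      skip xs x≢s x≢s′ eq′ = trans (mem-∷-≢ {xs = xs} x≢s) (trans eq′ (sym (mem-∷-≢ {xs = xs} x≢s′)))
      agree : ∀ {xs} → xs ≡ J ⊎ xs ≡ a ∷ J ⊎ xs ≡ b ∷ J ⊎ xs ≡ a ∷ b ∷ J → mem xs s ≡ mem xs s′
      agree (inj₁ refl)               = eq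
      agree (inj₂ (inj₁ refl))        = skip J a≢s a≢s′ eq
      agree (inj₂ (inj₂ (inj₁ refl))) = skip J b≢s b≢s′ eq
      agree (inj₂ (inj₂ (inj₂ refl))) = skip (b ∷ J) a≢s a≢s′ (skip J b≢s b≢s′ eq)

    -- The coordinate of `uv` is the one left out: the equation of the face can be solved for it,
    -- and the surplus `E u v` in the special shifts vanishes everywhere else.
    pivot = at-coord u≢v

  c₀ : Coord n
  c₀ = proj₁ pivot

  open Coordinates c₀

  private
    E-uv≡0 : ∀ {c} → c ≢ c₀ → E u v c ≡ 0ℚ
    E-uv≡0 {c} c≢c₀ = E-¬isPair {c = c} λ c≡uv → c≢c₀ (isPair-unique c≡uv (proj₁ (proj₂ pivot)))

    OffPivot : Fin n → Fin n → Set
    OffPivot a b = Σ (Vect n) λ t → Shift F t × (∀ c → c ≢ c₀ → t c ≡ E a b c)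

    off-uv′ : OffPivot u v′
    off-uv′ = _ , shift-uv′ , λ { c@((w , w′) , _) c≢c₀ → trans
      (solve 6 (λ u u′ v v′ x x′ → u :* (v′ :+ x′) :+ (v :+ x) :* u′ := (u :* v′ :+ v :* u′) :+ (u :* x′ :+ x :* u′))
        refl (δ u w) (δ u w′) (δ v w) (δ v w′) (δ v′ w) (δ v′ w′))
      (trans (cong (_+ E u v′ c) (E-uv≡0 c≢c₀)) (+-identityˡ _)) }

    off-vu′ : OffPivot v u′
    off-vu′ = _ , shift-vu′ , λ { c@((w , w′) , _) c≢c₀ → trans
      (solve 6 (λ v v′ u u′ x x′ → v :* (u′ :+ x′) :+ (u :+ x) :* v′ := (u :* v′ :+ v :* u′) :+ (v :* x′ :+ x :* v′))
        refl (δ v w) (δ v w′) (δ u w) (δ u w′) (δ u′ w) (δ u′ w′))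
      (trans (cong (_+ E v u′ c) (E-uv≡0 c≢c₀)) (+-identityˡ _)) }

    off-u′v′ : OffPivot u′ v′
    off-u′v′ = _ , shift-u′v′ , λ c c≢c₀ →
      trans (cong (λ y → E u′ v′ c - y) (E-uv≡0 c≢c₀)) (+-identityʳ _)

    off-comm : ∀ a b → OffPivot a b → OffPivot b a
    off-comm a b (t , s , eq) = t , s , λ c c≢c₀ → trans (eq c c≢c₀) (E-comm a b c)

    terminal? : ∀ s s′ (a : Fin n) → Dec (a ≡ s ⊎ a ≡ s′)
    terminal? s s′ a = (a ≟ᶠ s) ⊎-dec (a ≟ᶠ s′)

    off-clear-u : ∀ {a b} → a ≢ b → ¬ (a ≡ u ⊎ a ≡ u′) → ¬ (b ≡ u ⊎ b ≡ u′) → OffPivot a b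
    off-clear-u a≢b a∉ b∉ = _ , shift-clear u~u′ agree-u a≢b
      (a∉ ∘ inj₁) (a∉ ∘ inj₂) (b∉ ∘ inj₁) (b∉ ∘ inj₂) , λ _ _ → refl

    off-clear-v : ∀ {a b} → a ≢ b → ¬ (a ≡ v ⊎ a ≡ v′) → ¬ (b ≡ v ⊎ b ≡ v′) → OffPivot a b
    off-clear-v a≢b a∉ b∉ = _ , shift-clear v~v′ agree-v a≢b
      (a∉ ∘ inj₁) (a∉ ∘ inj₂) (b∉ ∘ inj₁) (b∉ ∘ inj₂) , λ _ _ → refl

    off-mixed : ∀ {a b} → ¬ (a ≡ u × b ≡ v) → a ≡ u ⊎ a ≡ u′ → b ≡ v ⊎ b ≡ v′ → OffPivot a b
    off-mixed a,b≢u,v (inj₁ a≡u)  (inj₁ b≡v)  = contradiction (a≡u , b≡v) a,b≢u,v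
    off-mixed _       (inj₁ refl) (inj₂ refl) = off-uv′
    off-mixed _       (inj₂ refl) (inj₁ refl) = off-comm v u′ off-vu′
    off-mixed _       (inj₂ refl) (inj₂ refl) = off-u′v′

    u-not-v : ∀ {a} → a ≡ u ⊎ a ≡ u′ → ¬ (a ≡ v ⊎ a ≡ v′)
    u-not-v (inj₁ refl) = [ u≢v , u≢v′ ]′
    u-not-v (inj₂ refl) = [ u′≢v , u′≢v′ ]′

    -- If `ab` misses `{u, u′}` or misses `{v, v′}`, balancing along that edge applies. Otherwise it
    -- has one end in each set, which leaves the three special pairs besides `uv`.
    off-pivot : ∀ {a b} → a ≢ b → ¬ (a ≡ u × b ≡ v) → ¬ (b ≡ u × a ≡ v) → OffPivot a b
    off-pivot {a} {b} a≢b ≢uv ≢vu with terminal? u u′ a | terminal? u u′ b | terminal? v v′ a | terminal? v v′ b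
    ... | yes a∈u | _       | _       | yes b∈v = off-mixed ≢uv a∈u b∈v
    ... | yes a∈u | _       | _       | no b∉v  = off-clear-v a≢b (u-not-v a∈u) b∉v
    ... | no _    | yes b∈u | yes a∈v | _       = off-comm b a (off-mixed ≢vu b∈u a∈v)
    ... | no _    | yes b∈u | no a∉v  | _       = off-clear-v a≢b a∉v (u-not-v b∈u)
    ... | no a∉u  | no b∉u  | _       | _       = off-clear-u a≢b a∉u b∉u

  rank-Face : HasAffRank (Face G (ineq u u′ v v′)) (suc R)
  rank-Face = simplex F-mid F-I directions , rank-≤ determined
    where
    open AffineRank {K = F} others
    directions : ∀ i → Direction (δ i)
    directions i =
      let (a , b) , a<b = others i
          is-pivot : ∀ {c} → IsPair c u v → c ≡ c₀
          is-pivot p = isPair-unique p (proj₁ (proj₂ pivot))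
          t , s , eq = off-pivot (<⇒≢ a<b)
            (λ { (a≡u , b≡v) → others-≢ i (is-pivot (inj₁ (cong₂ _,_ a≡u b≡v))) })
            (λ { (b≡u , a≡v) → others-≢ i (is-pivot (inj₂ (cong₂ _,_ a≡v b≡u))) })
      in shift⇒direction s λ j → trans (eq (others j) (others-≢ j)) (E-of-δ others others-injective i j)
    determined : Determined
    determined m p p∈F μ _ vanish c with coord≟ c c₀
    ... | no c≢c₀ with others-complete c c≢c₀
    ...   | j , refl = vanish j
    -- The equation of the face gives `x c₀` as `x c₁ + x c₂ - x c₃`. It is linear and homogeneous,
    -- so the combination vanishes at `c₀` too.
    determined m p p∈F μ _ vanish c | yes refl = begin
      Σμ c₀
        ≡⟨ sum-cong m expand ⟩
      sumFin m (λ i → μ i * p i c₁ + (μ i * p i c₂ + - 1ℚ * (μ i * p i c₃)))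
        ≡⟨ sum-+ m _ _ ⟩
      Σμ c₁ + sumFin m (λ i → μ i * p i c₂ + - 1ℚ * (μ i * p i c₃))
        ≡⟨ cong (Σμ c₁ +_) (trans (sum-+ m _ _) (cong (Σμ c₂ +_) (sum-*ˡ m (- 1ℚ) (λ i → μ i * p i c₃)))) ⟩
      Σμ c₁ + (Σμ c₂ + - 1ℚ * Σμ c₃)
        ≡⟨ cong₂ _+_ (vanish′ c₁≢c₀) (cong₂ (λ x y → x + - 1ℚ * y) (vanish′ c₂≢c₀) (vanish′ c₃≢c₀)) ⟩
      0ℚ ∎
      where
      open ≡-Reasoning
      Σμ : Coord n → ℚ
      Σμ c = sumFin m (λ i → μ i * p i c)
      vanish′ : ∀ {c} → c ≢ c₀ → Σμ c ≡ 0ℚ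
      vanish′ c≢c₀ with others-complete _ c≢c₀
      ... | j , refl = vanish j
      coord₁ = at-coord u≢v′
      coord₂ = at-coord (≢-sym u′≢v)
      coord₃ = at-coord u′≢v′
      c₁ = proj₁ coord₁
      c₂ = proj₁ coord₂
      c₃ = proj₁ coord₃
      c₁≢c₀ : c₁ ≢ c₀
      c₁≢c₀ = isPair-≢ (proj₁ (proj₂ coord₁)) (proj₁ (proj₂ pivot)) (inj₂ (≢-sym v≢v′)) (inj₁ u≢v)
      c₂≢c₀ : c₂ ≢ c₀
      c₂≢c₀ = isPair-≢ (proj₁ (proj₂ coord₂)) (proj₁ (proj₂ pivot)) (inj₁ (≢-sym u≢v)) (inj₂ (≢-sym u≢u′))
      c₃≢c₀ : c₃ ≢ c₀
      c₃≢c₀ = isPair-≢ (proj₁ (proj₂ coord₃)) (proj₁ (proj₂ pivot)) (inj₁ (≢-sym u≢u′)) (inj₁ u′≢v)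
      expand : ∀ i → μ i * p i c₀ ≡ μ i * p i c₁ + (μ i * p i c₂ + - 1ℚ * (μ i * p i c₃))
      expand i = begin
        μ i * p i c₀
          ≡⟨ solve 3 (λ m x y → m :* x := m :* (x :+ y) :+ con (- 1ℚ) :* (m :* y)) refl (μ i) (p i c₀) (p i c₃) ⟩
        μ i * (p i c₀ + p i c₃) + - 1ℚ * (μ i * p i c₃)
          ≡⟨ cong (λ y → μ i * y + - 1ℚ * (μ i * p i c₃)) on-face ⟩
        μ i * (p i c₁ + p i c₂) + - 1ℚ * (μ i * p i c₃)
          ≡⟨ solve 4 (λ m x y z → m :* (x :+ y) :+ z := m :* x :+ (m :* y :+ z)) refl
               (μ i) (p i c₁) (p i c₂) (- 1ℚ * (μ i * p i c₃)) ⟩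
        μ i * p i c₁ + (μ i * p i c₂ + - 1ℚ * (μ i * p i c₃)) ∎
        where
        on-face : p i c₀ + p i c₃ ≡ p i c₁ + p i c₂
        on-face = trans (sym (cong₂ _+_ (proj₂ (proj₂ pivot) (p i)) (proj₂ (proj₂ coord₃) (p i))))
          (trans (proj₂ (p∈F i)) (cong₂ _+_ (proj₂ (proj₂ coord₁) (p i)) (proj₂ (proj₂ coord₂) (p i))))

  facet : FacetDefining G (ineq u u′ v v′)
  facet = suc R , rank-LMC G conn c₀ , rank-Face

-- Symmetry under exchanging `u` with `u′` and `v` with `v′`

HasAffRank-cong : ∀ {n} {S T : Vect n → Set} {r} → (∀ {x} → S x → T x) → (∀ {x} → T x → S x) →
  HasAffRank S r → HasAffRank T r
HasAffRank-cong S⊆T T⊆S ((p , p∈S , independent) , maximal) =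
  (p , S⊆T ∘ p∈S , independent) , λ m q q∈T → maximal m q (T⊆S ∘ q∈T)

ineq-swap : ∀ {n} (u u′ v v′ : Fin n) (x : Vect n) →
  lhs (ineq u u′ v v′) x ≡ rhs (ineq u u′ v v′) x → lhs (ineq u′ u v′ v) x ≡ rhs (ineq u′ u v′ v) x
ineq-swap u u′ v v′ x eq = begin
  at x u′ v′ + at x u v   ≡⟨ +-comm (at x u′ v′) (at x u v) ⟩
  at x u v + at x u′ v′   ≡⟨ eq ⟩
  at x u v′ + at x v u′   ≡⟨ +-comm (at x u v′) (at x v u′) ⟩
  at x v u′ + at x u v′   ≡⟨ cong₂ _+_ (at-comm x v u′) (at-comm x u v′) ⟩
  at x u′ v + at x v′ u   ∎
  where open ≡-Reasoning

facet-swap : ∀ {n} (G : Graph n) (u u′ v v′ : Fin n) →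
  FacetDefining G (ineq u′ u v′ v) → FacetDefining G (ineq u u′ v v′)
facet-swap G u u′ v v′ (r , rank-G , rank-F) = r , rank-G , HasAffRank-cong
  {S = Face G (ineq u′ u v′ v)} {T = Face G (ineq u u′ v v′)}
  (λ { {x} (x∈ , eq) → x∈ , ineq-swap u′ u v′ v x eq })
  (λ { {x} (x∈ , eq) → x∈ , ineq-swap u u′ v v′ x eq }) rank-F

-- From separation to a facet

module _ {n} (G : Graph n) where

  separating⇒facet : Connected G → ∀ {u u′ v v′} → Edge G u u′ → Edge G v v′ →
    u ≢ u′ → u ≢ v → u ≢ v′ → u′ ≢ v → u′ ≢ v′ → v ≢ v′ →
    Separating G (λ w → w ≡ u ⊎ w ≡ v′) v u′ → Separating G (λ w → w ≡ v ⊎ w ≡ u′) u v′ →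
    FacetDefining G (ineq u u′ v v′)
  separating⇒facet conn {u} {u′} {v} {v′} u~u′ v~v′ u≢u′ u≢v u≢v′ u′≢v u′≢v′ v≢v′ sep-vu′ sep-uv′
    with crossing G (λ w → (w ≟ᶠ u) ⊎-dec (w ≟ᶠ u′)) (λ w → (w ≟ᶠ v) ⊎-dec (w ≟ᶠ v′))
           (proj₁ (proj₂ (conn u v))) (inj₁ refl) [ u≢v , u≢v′ ]′ (inj₁ refl)
  ... | s , t , s∈ , t∈ , I = go s∈ t∈ link
    where
    open Interior I
    u∉ : u ∉ inner
    u∉ u∈ = proj₁ (All.lookup avoid u∈) (inj₁ refl)
    u′∉ : u′ ∉ inner
    u′∉ u′∈ = proj₁ (All.lookup avoid u′∈) (inj₂ refl)
    v∉ : v ∉ inner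
    v∉ v∈ = proj₂ (All.lookup avoid v∈) (inj₁ refl)
    v′∉ : v′ ∉ inner
    v′∉ v′∈ = proj₂ (All.lookup avoid v′∈) (inj₂ refl)
    -- The ends and the interior form a connected set, so some path between the ends stays inside it
    -- and misses `S`. This excludes crossings from `u` to `v′` and from `u′` to `v`.
    unseparated : ∀ {a b} {S : Fin n → Set} → Link G a b inner → (∀ {w} → S w → w ∉ a ∷ b ∷ inner) →
      ¬ Separating G S a b
    unseparated {a} {b} link S∉ sep =
      let T = grow (grow tree (link-attached G (link-sym G link))) (link-attached-∷ G link)
          xs , π , xs⊆ = reach⇒path G (tree-reach G T (here refl) (there (here refl)))
          w , w∈xs , Sw = find (sep xs π)
      in S∉ Sw (All.lookup xs⊆ w∈xs)
    outside : ∀ {w a b} → w ≢ a → w ≢ b → w ∉ inner → w ∉ a ∷ b ∷ inner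
    outside w≢a _   _  (here w≡a)          = w≢a w≡a
    outside _   w≢b _  (there (here w≡b))  = w≢b w≡b
    outside _   _   w∉ (there (there w∈))  = w∉ w∈
    go : s ≡ u ⊎ s ≡ u′ → t ≡ v ⊎ t ≡ v′ → Link G s t inner → FacetDefining G (ineq u u′ v v′)
    go (inj₁ refl) (inj₁ refl) link =
      FaceRank.facet G conn u u′ v v′ u~u′ v~v′ u≢u′ u≢v u≢v′ u′≢v u′≢v′ v≢v′ tree link u∉ u′∉ v∉ v′∉
    -- A crossing from `u′` to `v′` is the previous case after exchanging primed and unprimed nodes.
    go (inj₂ refl) (inj₂ refl) link = facet-swap G u u′ v v′
      (FaceRank.facet G conn u′ u v′ v (edge-sym G u~u′) (edge-sym G v~v′) (≢-sym u≢u′) u′≢v′ u′≢v u≢v′ u≢v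
        (≢-sym v≢v′) tree link u′∉ u∉ v′∉ v∉)
    go (inj₁ refl) (inj₂ refl) link = contradiction sep-uv′ (unseparated link λ
      { (inj₁ refl) → outside (≢-sym u≢v) v≢v′ v∉ ; (inj₂ refl) → outside (≢-sym u≢u′) u′≢v′ u′∉ })
    go (inj₂ refl) (inj₁ refl) link = contradiction sep-vu′ (unseparated (link-sym G link) λ
      { (inj₁ refl) → outside u≢v u≢u′ u∉ ; (inj₂ refl) → outside (≢-sym v≢v′) (≢-sym u′≢v′) v′∉ })

  -- From separation to validity

  at-lmcVec-≤1 : ∀ (d : Decomposition G) {a b} → a ≢ b → at (lmcVec d) a b ≤ 1ℚ
  at-lmcVec-≤1 d {a} {b} a≢b with label d a ≟ᶠ label d b
  ... | yes eq = subst (_≤ 1ℚ) (sym (at-lmcVec-together d a≢b eq)) (nonNegative⁻¹ 1ℚ)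
  ... | no neq = ≤-reflexive (at-lmcVec-apart d a≢b neq)

  separator-in-block : ∀ {S a b} → Separating G S a b → (d : Decomposition G) → label d a ≡ label d b →
    ∃[ w ] S w × label d w ≡ label d a
  separator-in-block sep d eq =
    let xs , π , same = blockConnected d _ _ eq
        w , w∈xs , Sw = find (sep xs π)
    in w , Sw , All.lookup same w∈xs

  module _ {u u′ v v′ : Fin n} (u≢v : u ≢ v) (u≢v′ : u ≢ v′) (u′≢v : u′ ≢ v) (u′≢v′ : u′ ≢ v′) where

    -- The cases follow the terms on the right. If both are 1, the bound is immediate. If exactly
    -- one is 0, a separating node in the common block forces a term on the left to be 0.
    separating⇒vertex-valid :
      Separating G (λ w → w ≡ u ⊎ w ≡ v′) v u′ → Separating G (λ w → w ≡ v ⊎ w ≡ u′) u v′ →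
      ∀ d → lhs (ineq u u′ v v′) (lmcVec d) ≤ rhs (ineq u u′ v v′) (lmcVec d)
    separating⇒vertex-valid sep-vu′ sep-uv′ d = go (ℓ u ≟ᶠ ℓ v′) (ℓ v ≟ᶠ ℓ u′)
      where
      ℓ = label d
      x = lmcVec d
      v≢u′ = ≢-sym u′≢v
      uv-together : ℓ u ≡ ℓ v → at x u v + at x u′ v′ ≤ 1ℚ
      uv-together eq = +-mono-≤ (≤-reflexive (at-lmcVec-together d u≢v eq)) (at-lmcVec-≤1 d u′≢v′)
      u′v′-together : ℓ u′ ≡ ℓ v′ → at x u v + at x u′ v′ ≤ 1ℚ
      u′v′-together eq = +-mono-≤ (at-lmcVec-≤1 d u≢v) (≤-reflexive (at-lmcVec-together d u′≢v′ eq))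
      all-together : ℓ u ≡ ℓ v → ℓ u ≡ ℓ v′ → ℓ v ≡ ℓ u′ → at x u v + at x u′ v′ ≤ at x u v′ + at x v u′
      all-together uv uv′ vu′ = ≤-reflexive (trans
        (cong₂ _+_ (at-lmcVec-together d u≢v uv)
          (at-lmcVec-together d u′≢v′ (trans (sym vu′) (trans (sym uv) uv′))))
        (sym (cong₂ _+_ (at-lmcVec-together d u≢v′ uv′) (at-lmcVec-together d v≢u′ vu′))))
      go : Dec (ℓ u ≡ ℓ v′) → Dec (ℓ v ≡ ℓ u′) → at x u v + at x u′ v′ ≤ at x u v′ + at x v u′
      go (no uv′) (no vu′) = subst (at x u v + at x u′ v′ ≤_)
        (sym (cong₂ _+_ (at-lmcVec-apart d u≢v′ uv′) (at-lmcVec-apart d v≢u′ vu′)))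
        (+-mono-≤ (at-lmcVec-≤1 d u≢v) (at-lmcVec-≤1 d u′≢v′))
      go (yes uv′) (no vu′) = subst (at x u v + at x u′ v′ ≤_)
        (sym (cong₂ _+_ (at-lmcVec-together d u≢v′ uv′) (at-lmcVec-apart d v≢u′ vu′)))
        (case (separator-in-block sep-uv′ d uv′))
        where
        case : ∃[ w ] (w ≡ v ⊎ w ≡ u′) × ℓ w ≡ ℓ u → at x u v + at x u′ v′ ≤ 1ℚ
        case (_ , inj₁ refl , eq) = uv-together (sym eq)
        case (_ , inj₂ refl , eq) = u′v′-together (trans eq uv′)
      go (no uv′) (yes vu′) = subst (at x u v + at x u′ v′ ≤_)
        (sym (cong₂ _+_ (at-lmcVec-apart d u≢v′ uv′) (at-lmcVec-together d v≢u′ vu′)))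
        (case (separator-in-block sep-vu′ d vu′))
        where
        case : ∃[ w ] (w ≡ u ⊎ w ≡ v′) × ℓ w ≡ ℓ v → at x u v + at x u′ v′ ≤ 1ℚ
        case (_ , inj₁ refl , eq) = uv-together eq
        case (_ , inj₂ refl , eq) = u′v′-together (sym (trans eq vu′))
      -- Both right terms are 0, and the separating node merges the two blocks, so all four nodes
      -- are together and the left side is 0.
      go (yes uv′) (yes vu′) = case (separator-in-block sep-uv′ d uv′)
        where
        case : ∃[ w ] (w ≡ v ⊎ w ≡ u′) × ℓ w ≡ ℓ u → at x u v + at x u′ v′ ≤ at x u v′ + at x v u′
        case (_ , inj₁ refl , eq) = all-together (sym eq) uv′ vu′
        case (_ , inj₂ refl , eq) = all-together (sym (trans vu′ eq)) uv′ vu′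

    -- Both sides are linear in `x`, so the inequality passes to convex combinations.
    vertex-valid⇒valid :
      (∀ d → lhs (ineq u u′ v v′) (lmcVec d) ≤ rhs (ineq u u′ v v′) (lmcVec d)) → Valid G (ineq u u′ v v′)
    vertex-valid⇒valid vertex-valid x (k , d , μ , μ≥0 , _ , x-eq) = subst₂ _≤_
      (sym (combine u≢v u′≢v′)) (sym (combine u≢v′ (≢-sym u′≢v)))
      (sum-mono k λ i → *-monoˡ-≤-nonNeg (μ i) {{nonNegative (μ≥0 i)}} (vertex-valid (d i)))
      where
      at-sum : ∀ {a b} → a ≢ b → at x a b ≡ sumFin k (λ i → μ i * at (lmcVec (d i)) a b)
      at-sum a≢b with at-coord a≢b
      ... | c , _ , eq = trans (eq x) (trans (x-eq c)
        (sum-cong k λ i → cong (μ i *_) (sym (eq (lmcVec (d i))))))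
      combine : ∀ {a b a′ b′} → a ≢ b → a′ ≢ b′ →
        at x a b + at x a′ b′ ≡ sumFin k (λ i → μ i * (at (lmcVec (d i)) a b + at (lmcVec (d i)) a′ b′))
      combine a≢b a′≢b′ = trans (cong₂ _+_ (at-sum a≢b) (at-sum a′≢b′)) (trans (sym (sum-+ k _ _))
        (sum-cong k λ i → sym (*-distribˡ-+ (μ i) _ _)))

    -- From validity to separation

    valid-at-walk : Valid G (ineq u u′ v v′) → ∀ {a b xs} → Walk G a b xs → let f = mem xs in
      (1ℚ - f u * f v) + (1ℚ - f u′ * f v′) ≤ (1ℚ - f u * f v′) + (1ℚ - f v * f u′)
    valid-at-walk valid {xs = xs} w = subst₂ _≤_
      (cong₂ _+_ (at-blockVec (mem xs) u≢v) (at-blockVec (mem xs) u′≢v′))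
      (cong₂ _+_ (at-blockVec (mem xs) u≢v′) (at-blockVec (mem xs) (≢-sym u′≢v)))
      (valid (blockVec (mem xs)) (InLMC-tree G (walk-tree G w)))

    valid⇒separating-vu′ : Valid G (ineq u u′ v v′) → Separating G (λ w → w ≡ u ⊎ w ≡ v′) v u′
    valid⇒separating-vu′ valid xs (w , _) with any? (λ w → (w ≟ᶠ u) ⊎-dec (w ≟ᶠ v′)) xs
    ... | yes hit = hit
    -- The block contains `v` and `u′` but neither `u` nor `v′`: the left side is `1ℚ + 1ℚ`, while
    -- on the right only the `uv′` term survives.
    ... | no miss = contradiction
      (substitute (valid-at-walk valid w))
      (from-no ((1ℚ + 1ℚ) ≤? 1ℚ))
      where
      substitute : let f = mem xs in
        (1ℚ - f u * f v) + (1ℚ - f u′ * f v′) ≤ (1ℚ - f u * f v′) + (1ℚ - f v * f u′) → 1ℚ + 1ℚ ≤ 1ℚ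
      substitute
        rewrite mem-∉ {xs = xs} {u} (λ u∈ → miss (Any.map (λ { refl → inj₁ refl }) u∈))
              | mem-∉ {xs = xs} {v′} (λ v′∈ → miss (Any.map (λ { refl → inj₂ refl }) v′∈))
              | mem-∈ (walk-start G w) | mem-∈ (walk-end G w) = id

    valid⇒separating-uv′ : Valid G (ineq u u′ v v′) → Separating G (λ w → w ≡ v ⊎ w ≡ u′) u v′
    valid⇒separating-uv′ valid xs (w , _) with any? (λ w → (w ≟ᶠ v) ⊎-dec (w ≟ᶠ u′)) xs
    ... | yes hit = hit
    ... | no miss = contradiction
      (substitute (valid-at-walk valid w))
      (from-no ((1ℚ + 1ℚ) ≤? 1ℚ))
      where
      substitute : let f = mem xs in
        (1ℚ - f u * f v) + (1ℚ - f u′ * f v′) ≤ (1ℚ - f u * f v′) + (1ℚ - f v * f u′) → 1ℚ + 1ℚ ≤ 1ℚ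
      substitute
        rewrite mem-∉ {xs = xs} {v} (λ v∈ → miss (Any.map (λ { refl → inj₁ refl }) v∈))
              | mem-∉ {xs = xs} {u′} (λ u′∈ → miss (Any.map (λ { refl → inj₂ refl }) u′∈))
              | mem-∈ (walk-start G w) | mem-∈ (walk-end G w) = id

theorem6p11 : ∀ {n} (G : Graph n) → Connected G →
    (u u' v v' : Fin n) → Edge G u u' → Edge G v v' →
    u ≢ u' → u ≢ v → u ≢ v' → u' ≢ v → u' ≢ v' → v ≢ v' →
    (Valid G (ineq u u' v v') × FacetDefining G (ineq u u' v v')) ⇔
    (Separating G (λ w → w ≡ u ⊎ w ≡ v') v u' × Separating G (λ w → w ≡ v ⊎ w ≡ u') u v')
theorem6p11 G conn u u' v v' u~u' v~v' u≢u' u≢v u≢v' u'≢v u'≢v' v≢v' = mk⇔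
  (λ { (valid , _) → valid⇒separating-vu′ G u≢v u≢v' u'≢v u'≢v' valid
                   , valid⇒separating-uv′ G u≢v u≢v' u'≢v u'≢v' valid })
  (λ { (sep-vu' , sep-uv') →
       vertex-valid⇒valid G u≢v u≢v' u'≢v u'≢v'
         (separating⇒vertex-valid G u≢v u≢v' u'≢v u'≢v' sep-vu' sep-uv')
     , separating⇒facet G conn u~u' v~v' u≢u' u≢v u≢v' u'≢v u'≢v' v≢v' sep-vu' sep-uv' })
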